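{- Let $w$ be a positive integer. Any natural inglenook puzzle with $w$ wagons that can always be solved can be solved, from any starting position, in at most $2w^2+12w-10$ moves. Moreover, there are natural inglenook puzzles with $w$ wagons having starting positions that require at least $(w^2-1)/2$ moves to solve.
   Context: Inglenook puzzle: for positive integers $w,s,h,m_1,\ldots,m_s$ with $w<h+m_1+\cdots+m_s$, there are $s$ sidings of lengths $m_1,\ldots,m_s$, a headshunt of length $h$, and a set $W$ of $w$ wagons. A position is a tuple $(W_0,W_1,\ldots,W_s)$ of ordered subsets of $W$ that partition $W$, with $|W_0|\le h$ and $|W_i|\le m_i$ for $1\le i\le s$ ($W_0$ lists headshunt wagons from shunting engine to points; $W_i$ lists the wagons of Siding $i$ from points to buffer stop). A move is a pair of distinct positions $(W_0,\ldots,W_s)$, $(W_0',\ldots,W_s')$ such that for some $r\in\{1,\ldots,s\}$, $W_i=W_i'$ for all $i\in\{1,\ldots,s\}\setminus\{r\}$, and the concatenation of $W_0$ then $W_r$ equals the concatenation of $W_0'$ then $W_r'$. The inglenook graph has positions as vertices and moves as edges. A puzzle is given by a set $S$ of starting positions and a set $F$ of finishing positions; solving it from $p\in S$ means finding a path in the inglenook graph from $p$ to a position of $F$, and the puzzle can always be solved if this is possible for every $p\in S$. The puzzle is natural if $S$ is closed under permuting wagons (applying any bijection $W\to W$ to a position in $S$ gives a position in $S$), and there exist $z\in\{1,\ldots,s\}$ and $\omega\in W$ such that every finishing position has $\omega$ as the last entry of $W_z$. -}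

module Defs where

open import Data.Nat using (ℕ; zero; suc; _+_; _*_; _∸_; _≤_; _<_)
open import Data.Fin using (Fin)
open import Data.List using (List; _++_; map; concat; length; last; allFin)
open import Data.Vec using (Vec; lookup; toList; sum)
import Data.Vec as Vec
open import Data.Maybe using (Maybe; just)
open import Data.Product using (Σ; _×_; _,_; ∃; ∃-syntax)
open import Data.List.Relation.Binary.Permutation.Propositional using (_↭_)
open import Data.Fin.Permutation using (Permutation′; _⟨$⟩ʳ_)
open import Relation.Binary.PropositionalEquality using (_≡_; _≢_)
open import Relation.Nullary using (¬_)

-- A configuration with wagon set W = Fin w and s sidings:
-- (W₀ , (W₁ , … , W_s)).  W₀ lists headshunt wagons from shunting engine
-- to points; Wᵢ lists Siding i from points to buffer stop.
Config : ℕ → ℕ → Set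
Config w s = List (Fin w) × Vec (List (Fin w)) s

record IsPosition {w s : ℕ} (h : ℕ) (m : Vec ℕ s) (c : Config w s) : Set where
  constructor mkPos
  field
    partition : (Data.Product.proj₁ c ++ concat (toList (Data.Product.proj₂ c))) ↭ allFin w
    headCap   : length (Data.Product.proj₁ c) ≤ h
    sidingCap : (i : Fin s) → length (lookup (Data.Product.proj₂ c) i) ≤ lookup m i

record Move {w s : ℕ} (h : ℕ) (m : Vec ℕ s) (c c' : Config w s) : Set where
  constructor mkMove
  field
    pos      : IsPosition h m c
    pos'     : IsPosition h m c'
    distinct : c ≢ c'
    r        : Fin s
    others   : (i : Fin s) → i ≢ r →
               lookup (Data.Product.proj₂ c) i ≡ lookup (Data.Product.proj₂ c') i
    shunt    : Data.Product.proj₁ c ++ lookup (Data.Product.proj₂ c) r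
             ≡ Data.Product.proj₁ c' ++ lookup (Data.Product.proj₂ c') r

data Path {w s : ℕ} (h : ℕ) (m : Vec ℕ s) : ℕ → Config w s → Config w s → Set where
  here  : ∀ {c} → Path h m zero c c
  there : ∀ {n c c' c''} → Move h m c c' → Path h m n c' c'' → Path h m (suc n) c c''

record ValidLayout (w s h : ℕ) (m : Vec ℕ s) : Set where
  field
    s-pos : 0 < s
    h-pos : 0 < h
    m-pos : (i : Fin s) → 0 < lookup m i
    room  : w < h + sum m

record Puzzle (w s : ℕ) (h : ℕ) (m : Vec ℕ s) : Set₁ where
  field
    Start  : Config w s → Set
    Finish : Config w s → Set
    startPos  : ∀ c → Start c → IsPosition h m c
    finishPos : ∀ c → Finish c → IsPosition h m c
open Puzzle public

permuteConfig : {w s : ℕ} → Permutation′ w → Config w s → Config w s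
permuteConfig π (W₀ , Ws) = map (π ⟨$⟩ʳ_) W₀ , Vec.map (map (π ⟨$⟩ʳ_)) Ws

record Natural {w s h : ℕ} {m : Vec ℕ s} (P : Puzzle w s h m) : Set where
  field
    startClosed : (π : Permutation′ w) → ∀ c → Start P c → Start P (permuteConfig π c)
    z : Fin s
    ω : Fin w
    lastIsω : ∀ c → Finish P c → last (lookup (Data.Product.proj₂ c) z) ≡ just ω

SolvableIn : {w s h : ℕ} {m : Vec ℕ s} → Puzzle w s h m → ℕ → Config w s → Set
SolvableIn {h = h} {m} P n p = Σ (Config _ _) λ q → Finish P q × Path h m n p q

Solvable : {w s h : ℕ} {m : Vec ℕ s} → Puzzle w s h m → Config w s → Set
Solvable P p = ∃[ n ] SolvableIn P n p

AlwaysSolvable : {w s h : ℕ} {m : Vec ℕ s} → Puzzle w s h m → Set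
AlwaysSolvable P = ∀ p → Start P p → Solvable P p

{-# OPTIONS --safe #-}
module Submission where

-- Keep one headshunt slot free for transit and treat the rest of the headshunt as one
-- more stack (capacity h − 1) beside the sidings; a wagon passes between stacks in at
-- most two moves.  If k wagons remain, the spare capacity is at least that of every
-- stack, and three stacks are usable, then any wagon can be brought to the bottom of
-- any stack in 2k + 5 transfers: dig it out, park it on top of a full third stack, and
-- empty the target stack elsewhere.  If the stack is chosen suitably, fixing that wagon
-- and shortening its stack by one preserves these conditions until one wagon is left,
-- so w² + 6w − 6 transfers suffice.  Conversely, if one of
-- the conditions fails then some wagon (the last of W₀ followed by Wᵢ, the first of
-- W₀, or an end of the whole line) never changes, which naturality rules out.
--
-- For the lower bound take s = 2 and h = 2.  A move changes the number of ascents by at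
-- most one in total over the two readings W₁ᴿ W₀ W₂ and W₁ᴿ W₀ᴿ W₂ of the line, and
-- reversing the wagons changes this total by w(w − 1).
open import Defs
open import Data.Bool using (true; false; if_then_else_)
open import Data.Empty using (⊥; ⊥-elim)
open import Data.Fin using (Fin; zero; suc; toℕ; _≟_)
open import Data.Fin.Permutation using (Permutation′; _⟨$⟩ʳ_; _⟨$⟩ˡ_; transpose; inverseˡ; inverseʳ)
open import Data.Fin.Properties using (any?; punchInᵢ≢i) renaming (suc-injective to Fin-suc-injective)
open import Data.List using (List; []; _∷_; _++_; _∷ʳ_; map; length; concat; reverse; allFin; head; last; initLast; _∷ʳ′_) renaming (tabulate to tabulateₗ)
open import Data.List.Membership.DecPropositional using (_∈?_)
open import Data.List.Membership.Propositional using (_∈_; _∉_)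
open import Data.List.Membership.Propositional.Properties using (∈-∃++; ∈-++⁻; ∈-allFin; ∈-map⁺)
open import Data.List.Membership.Propositional.Properties.WithK using (unique∧set⇒bag)
open import Data.List.Properties using (map-++; length-++; length-map; length-reverse; length-tabulate; ++-assoc; ++-identityʳ; ++-cancelˡ; ++-conicalˡ; ++-conicalʳ; reverse-involutive; unfold-reverse; reverse-++; reverse-map; concat-map; map-tabulate; head-map; last-map; ∷-injectiveˡ; ∷-injectiveʳ) renaming (≡-dec to List-≡-dec)
open import Data.List.Relation.Binary.BagAndSetEquality using (∼bag⇒↭)
open import Data.List.Relation.Binary.Permutation.Propositional using (_↭_; ↭-refl; ↭-sym; ↭-trans; ↭-reflexive; swap)
open import Data.List.Relation.Binary.Permutation.Propositional.Properties using (++⁺ˡ; shifts; ↭-reverse; ↭-length; map⁺; ∈-resp-↭)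
open import Data.List.Relation.Unary.Any using (here; there)
import Data.List.Relation.Unary.Unique.Propositional.Properties as Unique
open import Data.Maybe as Maybe using (Maybe; just; nothing)
open import Data.Maybe.Properties using (just-injective)
open import Data.Nat using (ℕ; zero; suc; pred; _+_; _*_; _∸_; _≤_; _<_; z≤n; s≤s; s≤s⁻¹; >-nonZero; _<?_; _≤?_; _<ᵇ_)
open import Data.Nat.ListAction using () renaming (sum to sumₗ)
open import Data.Nat.ListAction.Properties using (sum-++; sum-↭)
open import Data.Nat.Properties hiding (_≟_)
open import Data.Nat.Solver using (module +-*-Solver)
open import Data.Product using (Σ; _×_; _,_; ∃₂; ∃-syntax; proj₁; proj₂)
open import Data.Product.Properties using () renaming (≡-dec to Product-≡-dec)
open import Data.Sum using (_⊎_; inj₁; inj₂)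
open import Data.Vec as Vec using (Vec; []; _∷_; lookup; toList; _[_]≔_; tabulate)
open import Data.Vec.Functional using (Vector; updateAt; removeAt)
open import Data.Vec.Functional.Properties using (updateAt-updates; updateAt-minimal; updateAt-updateAt-local; updateAt-id-local; updateAt-commutes)
open import Data.Vec.Properties using (lookup∘tabulate; tabulate∘lookup; tabulate-cong; lookup∘update; lookup∘update′; lookup-map; toList-map) renaming (≡-dec to Vec-≡-dec)
open import Algebra.Properties.CommutativeMonoid.Sum +-0-commutativeMonoid using (sum; sum-remove; sum-cong-≗)
open import Function using (_∘_; const; id)
open import Function.Bundles using (mk⇔)
open import Relation.Binary.PropositionalEquality
open import Relation.Nullary using (¬_; yes; no; does; contradiction)
open import Relation.Nullary.Decidable using (¬?; _×-dec_)
open +-*-Solver using (solve; _:=_; _:+_; _:*_; con)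

-- Sums over finite index sets

variable
  w t n k : ℕ

cancel-≤ : ∀ e {a b x y} → a ≤ b → x + e ≡ a → b ≡ y + e → x ≤ y
cancel-≤ e a≤b refl refl = +-cancelʳ-≤ e _ _ a≤b

sum-mono-≤ : {f g : Vector ℕ n} → (∀ i → f i ≤ g i) → sum f ≤ sum g
sum-mono-≤ {zero}  le = z≤n
sum-mono-≤ {suc n} le = +-mono-≤ (le zero) (sum-mono-≤ (le ∘ suc))

sum-zero : {f : Vector ℕ n} → (∀ i → f i ≡ 0) → sum f ≡ 0
sum-zero {zero}  f≡0 = refl
sum-zero {suc n} f≡0 = cong₂ _+_ (f≡0 zero) (sum-zero (f≡0 ∘ suc))

lookup≤sum : ∀ (f : Vector ℕ n) i → f i ≤ sum f
lookup≤sum {suc n} f i = ≤-trans (m≤m+n (f i) _) (≤-reflexive (sym (sum-remove {i = i} f)))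

-- Both sides contain `f j + g j`, so only the entries away from `j` are compared. Adding crosswise
-- avoids truncated subtraction.
sum-exchange : ∀ (f g : Vector ℕ n) j → (∀ l → l ≢ j → f l ≤ g l) →
               sum f + g j ≤ sum g + f j
sum-exchange {suc n} f g j f≤g = begin
  sum f + g j                          ≡⟨ cong (_+ g j) (sum-remove {i = j} f) ⟩
  f j + sum (removeAt f j) + g j       ≤⟨ +-monoˡ-≤ (g j) (+-monoʳ-≤ (f j) (sum-mono-≤ λ l → f≤g _ (punchInᵢ≢i j l))) ⟩
  f j + sum (removeAt g j) + g j       ≡⟨ solve 3 (λ a b c → a :+ b :+ c := c :+ b :+ a) refl (f j) _ (g j) ⟩
  g j + sum (removeAt g j) + f j       ≡⟨ cong (_+ f j) (sum-remove {i = j} g) ⟨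
  sum g + f j                          ∎
  where open ≤-Reasoning

sum-adjust : ∀ (f g : Vector ℕ n) j {c} → (∀ l → l ≢ j → f l ≡ g l) → f j ≡ c + g j →
             sum f ≡ c + sum g
sum-adjust f g j {c} same fj = ≤-antisym
  (cancel-≤ (g j) (sum-exchange f g j (λ l l≢ → ≤-reflexive (same l l≢))) refl
    (trans (cong (sum g +_) fj) (solve 3 (λ a b d → a :+ (b :+ d) := b :+ a :+ d) refl (sum g) c (g j))))
  (cancel-≤ (g j) (sum-exchange g f j (λ l l≢ → ≤-reflexive (sym (same l l≢))))
    (trans (solve 3 (λ a b d → b :+ a :+ d := a :+ (b :+ d)) refl (sum g) c (g j)) (cong (sum g +_) (sym fj))) refl)

sum-clear : ∀ (f : Vector ℕ n) j → sum f ≡ f j + sum (updateAt f j (const 0))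
sum-clear f j = sum-adjust f (updateAt f j (const 0)) j
  (λ l l≢ → sym (updateAt-minimal l j f l≢))
  (sym (trans (cong (f j +_) (updateAt-updates j f)) (+-identityʳ (f j))))

-- Stacks of wagons and additive weights

Stacks : ℕ → ℕ → Set
Stacks w t = Vector (List (Fin w)) t

weight : (Fin w → ℕ) → List (Fin w) → ℕ
weight φ l = sumₗ (map φ l)

-- Equality of totals for every `φ` stands for having the same wagons with multiplicity: `const 1`
-- counts wagons and `indicator x` counts copies of `x`.
total : (Fin w → ℕ) → Stacks w t → ℕ
total φ U = sum (weight φ ∘ U)

load : Stacks w t → ℕ
load = total (const 1)

weight-1≡length : (l : List (Fin w)) → weight (const 1) l ≡ length l
weight-1≡length []      = refl
weight-1≡length (x ∷ l) = cong suc (weight-1≡length l)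

load≡sum-length : (U : Stacks w t) → load U ≡ sum (length ∘ U)
load≡sum-length U = sum-cong-≗ (weight-1≡length ∘ U)

weight-∷ʳ : ∀ (φ : Fin w → ℕ) l x → weight φ (l ∷ʳ x) ≡ φ x + weight φ l
weight-∷ʳ φ l x = begin
  sumₗ (map φ (l ∷ʳ x))           ≡⟨ cong sumₗ (map-++ φ l (x ∷ [])) ⟩
  sumₗ (map φ l ∷ʳ φ x)           ≡⟨ sum-++ (map φ l) (φ x ∷ []) ⟩
  weight φ l + (φ x + 0)          ≡⟨ cong (weight φ l +_) (+-identityʳ (φ x)) ⟩
  weight φ l + φ x                ≡⟨ +-comm (weight φ l) (φ x) ⟩
  φ x + weight φ l                ∎
  where open ≡-Reasoning

-- The head of a list is the top of its stack, the end next to the points, so `sink` puts a wagon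
-- beneath all others.
push sink : Fin t → Fin w → Stacks w t → Stacks w t
push j x U = updateAt U j (x ∷_)
sink j x U = updateAt U j (_∷ʳ x)

total-cong : ∀ (φ : Fin w → ℕ) {U U′ : Stacks w t} → U ≗ U′ → total φ U ≡ total φ U′
total-cong φ U≗U′ = sum-cong-≗ (cong (weight φ) ∘ U≗U′)

total-push : ∀ (φ : Fin w → ℕ) j x (U : Stacks w t) → total φ (push j x U) ≡ φ x + total φ U
total-push φ j x U = sum-adjust _ _ j
  (λ l l≢ → cong (weight φ) (updateAt-minimal l j U l≢))
  (cong (weight φ) (updateAt-updates j U))

total-sink : ∀ (φ : Fin w → ℕ) j x (U : Stacks w t) → total φ (sink j x U) ≡ φ x + total φ U
total-sink φ j x U = sum-adjust _ _ j
  (λ l l≢ → cong (weight φ) (updateAt-minimal l j U l≢))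
  (trans (cong (weight φ) (updateAt-updates j U)) (weight-∷ʳ φ (U j) x))

-- Transfers between stacks

Fits : Vector ℕ t → Stacks w t → Set
Fits r U = ∀ l → length (U l) ≤ r l

-- V is what remains while x is in transit.
record Transfer (r : Vector ℕ t) (U U′ : Stacks w t) : Set where
  constructor transfer
  field
    i j  : Fin t
    x    : Fin w
    V    : Stacks w t
    from : U ≗ push i x V
    to   : U′ ≗ push j x V
    room : length (V j) < r j

-- The index bounds the number of transfers from above, since `done` accepts any `b`. Stacks are
-- functions, so they are compared pointwise.
data Reach {w t : ℕ} (r : Vector ℕ t) : ℕ → Stacks w t → Stacks w t → Set where
  done : ∀ {b U U′} → U ≗ U′ → Reach r b U U′
  step : ∀ {b U U′ U″} → Transfer r U U′ → Reach r b U′ U″ → Reach r (suc b) U U″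

variable
  r : Vector ℕ t
  U U′ U″ Q : Stacks w t
  a b c : ℕ

Reach-respˡ : U ≗ U′ → Reach r b U′ U″ → Reach r b U U″
Reach-respˡ U≗U′ (done U′≗U″) = done (λ l → trans (U≗U′ l) (U′≗U″ l))
Reach-respˡ U≗U′ (step (transfer i j x V from to room) p) =
  step (transfer i j x V (λ l → trans (U≗U′ l) (from l)) to room) p

Reach-respʳ : Reach r b U U′ → U′ ≗ U″ → Reach r b U U″
Reach-respʳ (done eq)  U′≗U″ = done (λ l → trans (eq l) (U′≗U″ l))
Reach-respʳ (step s p) U′≗U″ = step s (Reach-respʳ p U′≗U″)

Reach-weaken : a ≤ b → Reach r a U U′ → Reach r b U U′
Reach-weaken a≤b       (done eq)  = done eq
Reach-weaken (s≤s a≤b) (step s p) = step s (Reach-weaken a≤b p)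

infixr 5 _◅◅_
_◅◅_ : Reach r a U U′ → Reach r b U′ U″ → Reach r (a + b) U U″
_◅◅_ {a = a} {b = b} (done eq) p = Reach-weaken (m≤n+m b a) (Reach-respˡ eq p)
step s p ◅◅ q = step s (p ◅◅ q)

Transfer-total : ∀ (φ : Fin w → ℕ) {U U′ : Stacks w t} → Transfer r U U′ → total φ U ≡ total φ U′
Transfer-total φ {U} {U′} (transfer i j x V from to _) = begin
  total φ U             ≡⟨ total-cong φ from ⟩
  total φ (push i x V)  ≡⟨ total-push φ i x V ⟩
  φ x + total φ V       ≡⟨ total-push φ j x V ⟨
  total φ (push j x V)  ≡⟨ total-cong φ to ⟨
  total φ U′            ∎
  where open ≡-Reasoning

push-length : ∀ i x (V : Stacks w t) l → length (V l) ≤ length (push i x V l)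
push-length i x V l with l ≟ i
... | yes refl = ≤-trans (n≤1+n _) (≤-reflexive (cong length (sym (updateAt-updates i V))))
... | no l≢i   = ≤-reflexive (cong length (sym (updateAt-minimal l i V l≢i)))

Transfer-fits : Fits r U → Transfer r U U′ → Fits r U′
Transfer-fits {r = r} {U = U} {U′} fits (transfer i j x V from to room) l with l ≟ j
... | yes refl = ≤-trans (≤-reflexive (cong length (trans (to l) (updateAt-updates j V)))) room
... | no l≢j   = begin
  length (U′ l)               ≡⟨ cong length (trans (to l) (updateAt-minimal l j V l≢j)) ⟩
  length (V l)           ≤⟨ push-length i x V l ⟩
  length (push i x V l)  ≡⟨ cong length (from l) ⟨
  length (U l)           ≤⟨ fits l ⟩
  r l                    ∎
  where open ≤-Reasoning

Reach-total : ∀ (φ : Fin w → ℕ) {U U′ : Stacks w t} → Reach r b U U′ → total φ U ≡ total φ U′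
Reach-total φ (done eq)  = total-cong φ eq
Reach-total φ (step s p) = trans (Transfer-total φ s) (Reach-total φ p)

Reach-fits : Fits r U → Reach r b U U′ → Fits r U′
Reach-fits {U = U} fits (done eq) l = ≤-trans (≤-reflexive (cong length (sym (eq l)))) (fits l)
Reach-fits {U = U} fits (step {U′ = U′} s p) = Reach-fits {U = U′} (Transfer-fits {U = U} {U′} fits s) p

-- Wagons fixed at the bottom of a stack

push-sink : ∀ i j x y (V : Stacks w t) → sink j y (push i x V) ≗ push i x (sink j y V)
push-sink i j x y V l with i ≟ j
... | no i≢j   = updateAt-commutes j i (i≢j ∘ sym) V l
... | yes refl = trans (updateAt-updateAt-local i {h = λ v → x ∷ v ∷ʳ y} V refl l)
                       (sym (updateAt-updateAt-local i V refl l))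

sink-cong : ∀ j y → U ≗ U′ → sink j y U ≗ sink j y U′
sink-cong {U = U} {U′} j y eq l with l ≟ j
... | yes refl = trans (updateAt-updates l U) (trans (cong (_∷ʳ y) (eq l)) (sym (updateAt-updates l U′)))
... | no l≢j   = trans (updateAt-minimal l j U l≢j) (trans (eq l) (sym (updateAt-minimal l j U′ l≢j)))

length-∷ʳ : ∀ (l : List (Fin w)) x → length (l ∷ʳ x) ≡ suc (length l)
length-∷ʳ l x = trans (length-++ l) (+-comm (length l) 1)

module _ {r r′ : Vector ℕ t} (j : Fin t) (rj : r j ≡ suc (r′ j)) (rl : ∀ l → l ≢ j → r l ≡ r′ l)
         (y : Fin w) where

  sink-room : ∀ (V : Stacks w t) l → length (V l) < r′ l → length (sink j y V l) < r l
  sink-room V l lt with l ≟ j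
  ... | yes refl = subst₂ _<_ (sym (trans (cong length (updateAt-updates l V)) (length-∷ʳ (V l) y))) (sym rj) (s≤s lt)
  ... | no l≢j   = subst₂ _<_ (cong length (sym (updateAt-minimal l j V l≢j))) (sym (rl l l≢j)) lt

  -- A wagon fixed at the bottom of `j` adds one both to the length of that stack and to its
  -- capacity, so each transfer still has room, and transfers touch only tops.
  Reach-sink : Reach r′ b U U′ → Reach r b (sink j y U) (sink j y U′)
  Reach-sink (done eq) = done (sink-cong j y eq)
  Reach-sink (step (transfer i g x V from to room) p) =
    step (transfer i g x (sink j y V)
           (λ l → trans (sink-cong j y from l) (push-sink i j x y V l))
           (λ l → trans (sink-cong j y to l) (push-sink g j x y V l))
           (sink-room V g room))
         (Reach-sink p)

-- Bringing one wagon to the bottom of a given stack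

Spare : ℕ → Vector ℕ t → Set
Spare k r = ∀ i → k + r i ≤ sum r

-- Phrased as needed in use: a third stack besides source and target. As soon as there is a stack,
-- it amounts to three stacks of positive capacity.
Rich : Vector ℕ t → Set
Rich r = ∀ i j → ∃[ g ] (g ≢ i × g ≢ j × 0 < r g)

length≤load : ∀ (U : Stacks w t) i → length (U i) ≤ load U
length≤load U i = ≤-trans (lookup≤sum (length ∘ U) i) (≤-reflexive (sym (load≡sum-length U)))

pop-top : ∀ {i x l} → U i ≡ x ∷ l → U ≗ push i x (updateAt U i (const l))
pop-top {U = U} {i} {x} {l} Ui m =
  sym (trans (updateAt-updateAt-local i {h = const (x ∷ l)} U refl m)
             (updateAt-id-local i U (sym Ui) m))

move : ∀ {i j x l} → U i ≡ x ∷ l → i ≢ j → length (U j) < r j →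
       ∃[ U′ ] (Transfer r U U′ × U′ i ≡ l × U′ j ≡ x ∷ U j × (∀ m → m ≢ i → m ≢ j → U′ m ≡ U m))
move {U = U} {r = r} {i} {j} {x} {l} Ui i≢j room =
  push j x V , transfer i j x V (pop-top Ui) (λ _ → refl) (subst (λ z → length z < r j) (sym Vj) room) ,
  trans (updateAt-minimal i j V i≢j) (updateAt-updates i U) ,
  trans (updateAt-updates j V) (cong (x ∷_) Vj) ,
  λ m m≢i m≢j → trans (updateAt-minimal m j V m≢j) (updateAt-minimal m i U m≢i)
  where
  V = updateAt U i (const l)
  Vj = updateAt-minimal j i U (i≢j ∘ sym)

Sunk : Vector ℕ t → Fin w → Fin t → ℕ → Stacks w t → Set
Sunk r x j b U = ∃[ U′ ] (Reach r b U U′ × ∃[ l ] U′ j ≡ l ∷ʳ x)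

Sunk-step : ∀ {x j} → Transfer r U U′ → Sunk r x j b U′ → Sunk r x j (suc b) U
Sunk-step s (U″ , p , q) = U″ , step s p , q

Sunk-prepend : ∀ {x j} → Reach r a U U′ → Sunk r x j b U′ → Sunk r x j (a + b) U
Sunk-prepend p (U″ , q , e) = U″ , p ◅◅ q , e

Sunk-weaken : ∀ {x j} → a ≤ b → Sunk r x j a U → Sunk r x j b U
Sunk-weaken a≤b (U′ , p , e) = U′ , Reach-weaken a≤b p , e

record Tidy (r : Vector ℕ t) (k : ℕ) (U : Stacks w t) : Set where
  constructor tidy
  field
    fits  : Fits r U
    loadₖ : load U ≡ k

Reach-tidy : Tidy r k U → Reach r b U U′ → Tidy r k U′
Reach-tidy {U = U} {U′ = U′} (tidy fits loadₖ) p =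
  tidy (Reach-fits {U = U} {U′ = U′} fits p) (trans (sym (Reach-total (const 1) p)) loadₖ)

Transfer-tidy : Tidy r k U → Transfer r U U′ → Tidy r k U′
Transfer-tidy T s = Reach-tidy T (step {b = 0} s (done λ _ → refl))

module Placing {w t : ℕ} (r : Vector ℕ t) (k : ℕ) (spare : Spare k r) where
  open Tidy

  -- If every other stack were full, the wagons outside `j` would number at least `sum r ∸ r j`,
  -- which is at least `k` by `Spare`; then `j` would be empty.
  room-elsewhere : ∀ {U : Stacks w t} {j y ys} → Tidy r k U → U j ≡ y ∷ ys → ∃[ l ] (l ≢ j × length (U l) < r l)
  room-elsewhere {U} {j} T Uj with any? (λ l → ¬? (l ≟ j) ×-dec (length (U l) <? r l))
  ... | yes found = found
  ... | no  none  = contradiction (trans (cong length (sym Uj)) (n≤0⇒n≡0 empty)) λ ()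
    where
    full : ∀ l → l ≢ j → r l ≤ length (U l)
    full l l≢j = ≮⇒≥ λ lt → none (l , l≢j , lt)
    k≡ : sum (length ∘ U) ≡ k
    k≡ = trans (sym (load≡sum-length U)) (loadₖ T)
    empty : length (U j) ≤ 0
    empty = cancel-≤ (k + r j)
      (begin
        k + r j + length (U j)                ≤⟨ +-monoˡ-≤ (length (U j)) (spare j) ⟩
        sum r + length (U j)                  ≤⟨ sum-exchange r (length ∘ U) j full ⟩
        sum (length ∘ U) + r j                ≡⟨ cong (_+ r j) k≡ ⟩
        k + r j                               ∎)
      (+-comm (length (U j)) (k + r j)) refl
      where open ≤-Reasoning

  finish : ∀ {U : Stacks w t} {i j x l} → i ≢ j → U i ≡ x ∷ l → U j ≡ [] → 0 < r j → Sunk r x j 1 U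
  finish {U} {i} {j} {x} i≢j Ui Uj rj
    with U′ , s , _ , U′j , _ ← move {U = U} {r = r} Ui i≢j (subst (λ z → length z < r j) (sym Uj) rj) =
    U′ , step s (done λ _ → refl) , [] , trans U′j (cong (x ∷_) Uj)

  -- The wagon `x` waits on top of the full stack `i`. Being full, `i` is never the stack with room,
  -- so the wagons unloaded from `j` never bury `x`, and one more transfer brings it to the emptied
  -- stack.
  settle : ∀ ys {U : Stacks w t} {i j x l} → Tidy r k U → i ≢ j → U i ≡ x ∷ l → r i ≤ length (U i) →
           U j ≡ ys → 0 < r j → Sunk r x j (suc (length ys)) U
  settle [] T i≢j Ui full Uj rj = finish i≢j Ui Uj rj
  settle (y ∷ ys) {U} {i} {j} T i≢j Ui full Uj rj
    with m , m≢j , room ← room-elsewhere T Uj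
    with m ≟ i
  ... | yes refl = contradiction room (≤⇒≯ full)
  ... | no m≢i
    with U′ , s , U′j , _ , rest ← move {U = U} {r = r} Uj (m≢j ∘ sym) room
    with U′i ← rest i i≢j (m≢i ∘ sym) =
    Sunk-step s (settle ys (Transfer-tidy T s) i≢j (trans U′i Ui)
      (subst (λ z → r i ≤ length z) (sym U′i) full) U′j rj)

  -- Stack `j` is unloaded onto third stacks while one has room; once all are full, `x` is parked on
  -- one of them and `settle` takes over.
  lower : Rich r → ∀ ys {U : Stacks w t} {i j x l} → Tidy r k U → i ≢ j → U i ≡ x ∷ l →
          U j ≡ ys → 0 < r j → Sunk r x j (length ys + 4) U
  lower rich [] T i≢j Ui Uj rj = Sunk-weaken (s≤s z≤n) (finish i≢j Ui Uj rj)
  lower rich (y ∷ ys) {U} {i} {j} T i≢j Ui Uj rj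
    with any? (λ m → ¬? (m ≟ i) ×-dec ¬? (m ≟ j) ×-dec (length (U m) <? r m))
  ... | yes (m , m≢i , m≢j , room)
    with U′ , s , U′j , _ , rest ← move {U = U} {r = r} Uj (m≢j ∘ sym) room =
    Sunk-step s (lower rich ys (Transfer-tidy T s) i≢j (trans (rest i i≢j (m≢i ∘ sym)) Ui) U′j rj)
  ... | no none
    with g , g≢i , g≢j , rg ← rich i j
    -- `room-elsewhere` at `i` gives a stack with room; all third stacks are full, so it can only be
    -- `j`.
    with U g in Ug | ≮⇒≥ (λ lt → none (g , g≢i , g≢j , lt)) | room-elsewhere T Ui
  ... | [] | full | _ = contradiction (≤-trans rg full) λ ()
  ... | z ∷ zs | full | m , m≢i , room
    with m ≟ j
  ... | no m≢j = contradiction (m , m≢i , m≢j , room) none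
  ... | yes refl
    -- The top wagon `z` of the full stack `g` goes to `j` and `x` takes its slot, so `g` is full
    -- again with `x` on top.
    with U₁ , s₁ , U₁g , U₁j , rest₁ ← move {U = U} {r = r} Ug g≢j room
    with T₁ ← Transfer-tidy T s₁
    with U₁i ← rest₁ i (g≢i ∘ sym) i≢j
    with U₂ , s₂ , _ , U₂g , rest₂ ← move {U = U₁} {r = r} (trans U₁i Ui) (g≢i ∘ sym)
           (≤-trans (≤-reflexive (cong (suc ∘ length) U₁g))
                    (≤-trans (≤-reflexive (cong length (sym Ug))) (fits T g)))
    with U₂j ← trans (rest₂ j (i≢j ∘ sym) (g≢j ∘ sym)) U₁j =
    -- Two transfers park `x`; `settle` then unloads the wagons of `j` together with `z` and makes
    -- one final transfer: four beyond the original height of `j`.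
    Sunk-weaken (≤-reflexive (trans (cong (3 +_) (cong (suc ∘ length) Uj)) (+-comm 4 (suc (length ys)))))
      (Sunk-step s₁ (Sunk-step s₂ (settle (z ∷ U j) (Transfer-tidy T₁ s₂) g≢j U₂g
        (≤-trans full (≤-reflexive (cong length (sym (trans U₂g (cong (_ ∷_) U₁g)))))) U₂j rj)))

  dig : ∀ above {U : Stacks w t} {i x below} → Tidy r k U → U i ≡ above ++ x ∷ below →
        ∃[ U′ ] (Reach r (length above) U U′ × U′ i ≡ x ∷ below)
  dig [] {U} T Ui = U , done (λ _ → refl) , Ui
  dig (a ∷ above) {U} {i} T Ui
    with m , m≢i , room ← room-elsewhere T Ui
    with U′ , s , U′i , _ ← move {U = U} {r = r} Ui (m≢i ∘ sym) room
    with U″ , p , U″i ← dig above (Transfer-tidy T s) U′i = U″ , step s p , U″i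

  -- At most `k` transfers dig `x` out, one may be needed to take it off `j`, and `lower` costs at
  -- most `k + 4`.
  place : Rich r → ∀ {U : Stacks w t} {i x} → Tidy r k U → x ∈ U i → ∀ j → 0 < r j → Sunk r x j (2 * k + 5) U
  place rich {U} {i} {x} T x∈ j rj
    with above , below , Ui ← ∈-∃++ x∈
    with U′ , p , U′i ← dig above T Ui
    with T′ ← Reach-tidy T p = Sunk-weaken bound (Sunk-prepend p body)
    where
    ≤k : ∀ {U : Stacks w t} → Tidy r k U → ∀ l → length (U l) ≤ k
    ≤k {U} T l = ≤-trans (length≤load U l) (≤-reflexive (loadₖ T))
    from-elsewhere : ∀ {U : Stacks w t} {i l} → Tidy r k U → i ≢ j → U i ≡ x ∷ l → Sunk r x j (k + 4) U
    from-elsewhere {U} T i≢j Ui = Sunk-weaken (+-monoˡ-≤ 4 (≤k {U} T j)) (lower rich _ T i≢j Ui refl rj)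
    body : Sunk r x j (suc (k + 4)) U′
    body with i ≟ j
    ... | no i≢j = Sunk-weaken (n≤1+n _) (from-elsewhere T′ i≢j U′i)
    -- Here `x` already lies in the target stack, which `lower` cannot treat, so it first moves to
    -- another one.
    ... | yes refl
      with m , m≢i , room ← room-elsewhere T′ U′i
      with U″ , s , _ , U″m , _ ← move {U = U′} {r = r} U′i (m≢i ∘ sym) room =
      Sunk-step s (from-elsewhere (Transfer-tidy T′ s) m≢i U″m)
    bound : length above + suc (k + 4) ≤ 2 * k + 5
    bound = begin
      length above + suc (k + 4) ≤⟨ +-monoˡ-≤ _ (≤-trans (m≤m+n (length above) _)
                                     (≤-trans (≤-reflexive (sym (trans (cong length Ui) (length-++ above)))) (≤k {U} T i))) ⟩
      k + suc (k + 4)            ≡⟨ solve 1 (λ k → k :+ (con 1 :+ (k :+ con 4)) := con 2 :* k :+ con 5) refl k ⟩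
      2 * k + 5                  ∎
      where open ≤-Reasoning

-- With one wagon there are no others to clear, and a transfer may even return it to its own stack,
-- which covers the case where `x` is already in `j`.
place-single : ∀ {U : Stacks w t} {i x} → load U ≡ 1 → x ∈ U i → ∀ j → 0 < r j → Sunk r x j 1 U
place-single {t = t} {r = r} {U = U} {i} {x} load1 x∈ j rj with above , below , Ui ← ∈-∃++ x∈ =
  push j x V , step (transfer i j x V from (λ _ → refl) (≤-trans (s≤s (length≤load V j)) (subst (λ z → suc z ≤ r j) (sym loadV) rj))) (done λ _ → refl) ,
  [] , trans (updateAt-updates j V) (cong (x ∷_) (empty (V j) (≤-trans (length≤load V j) (≤-reflexive loadV))))
  where
  empty : ∀ (l : List (Fin _)) → length l ≤ 0 → l ≡ []
  empty [] _ = refl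
  single : ∀ above {below} → length (above ++ x ∷ below) ≤ 1 → above ++ x ∷ below ≡ x ∷ []
  single [] (s≤s le) = cong (x ∷_) (empty _ le)
  single (y ∷ above) (s≤s le) = contradiction
    (≤-trans (≤-trans (m≤n+m 1 (length above)) (≤-trans (+-monoʳ-≤ (length above) (s≤s z≤n)) (≤-reflexive (sym (length-++ above))))) le) λ ()
  Ui≡[x] : U i ≡ x ∷ []
  Ui≡[x] = trans Ui (single above (subst (λ z → length z ≤ 1) Ui
             (≤-trans (length≤load U i) (≤-reflexive load1))))
  V : Stacks _ t
  V = updateAt U i (const [])
  from : U ≗ push i x V
  from = pop-top Ui≡[x]
  loadV : load V ≡ 0
  loadV = suc-injective (trans (sym (total-push (const 1) i x V)) (trans (sym (total-cong (const 1) from)) load1))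

-- Locating a wagon by counting

indicator : Fin w → Fin w → ℕ
indicator x y = if does (x ≟ y) then 1 else 0

indicator-refl : ∀ (x : Fin w) → indicator x x ≡ 1
indicator-refl x with x ≟ x
... | yes _  = refl
... | no x≢x = contradiction refl x≢x

weight-∉ : ∀ {x : Fin w} {l} → x ∉ l → weight (indicator x) l ≡ 0
weight-∉ {l = []} x∉ = refl
weight-∉ {x = x} {y ∷ l} x∉ with x ≟ y
... | yes x≡y = contradiction (here x≡y) x∉
... | no  _   = weight-∉ (x∉ ∘ there)

-- If `x` were in no stack of `U`, its `indicator` total there would be zero, whereas the bottom
-- wagon of `Q j` contributes one.
locate : ∀ {j l x} → (∀ φ → total φ U ≡ total φ Q) → Q j ≡ l ∷ʳ x → ∃[ i ] x ∈ U i
locate {U = U} {Q = Q} {j} {l} {x} same Qj with any? (λ i → _∈?_ _≟_ x (U i))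
... | yes found = found
... | no  none  = contradiction
  (begin
    1                              ≤⟨ m≤m+n 1 _ ⟩
    1 + weight (indicator x) l     ≡⟨ cong (_+ weight (indicator x) l) (indicator-refl x) ⟨
    indicator x x + weight _ l     ≡⟨ weight-∷ʳ (indicator x) l x ⟨
    weight (indicator x) (l ∷ʳ x)  ≡⟨ cong (weight _) Qj ⟨
    weight (indicator x) (Q j)     ≤⟨ lookup≤sum (weight (indicator x) ∘ Q) j ⟩
    total (indicator x) Q          ≡⟨ same (indicator x) ⟨
    total (indicator x) U          ≡⟨ sum-zero (λ i → weight-∉ (λ x∈ → none (i , x∈))) ⟩
    0                              ∎) λ ()
  where open ≤-Reasoning

-- Choosing the stack to fix next

Feasible : ℕ → Vector ℕ t → Set
Feasible k r = k ≤ 1 ⊎ Spare k r × Rich r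

nonempty-stack : ∀ (Q : Stacks w t) → load Q ≡ suc k → ∃[ j ] 0 < length (Q j)
nonempty-stack Q load≡ with any? (λ j → 0 <? length (Q j))
... | yes found = found
... | no  none  = contradiction
  (trans (sym load≡) (trans (load≡sum-length Q) (sum-zero λ j → n≤0⇒n≡0 (≮⇒≥ λ lt → none (j , lt))))) λ ()

clear : Fin t → Vector ℕ t → Vector ℕ t
clear j f = updateAt f j (const 0)

clear-≤ : ∀ (f : Vector ℕ t) j l → clear j f l ≤ f l
clear-≤ f j l with l ≟ j
... | yes refl = ≤-trans (≤-reflexive (updateAt-updates j f)) z≤n
... | no l≢j   = ≤-reflexive (updateAt-minimal l j f l≢j)

clear-zero : ∀ {f : Vector ℕ t} {j l} → (l ≢ j → f l ≡ 0) → clear j f l ≡ 0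
clear-zero {f = f} {j} {l} z with l ≟ j
... | yes refl = updateAt-updates j f
... | no l≢j   = trans (updateAt-minimal l j f l≢j) (z l≢j)

-- Only an inequality, because the three indices may coincide.
sum-three : ∀ (f : Vector ℕ t) i j g → (∀ l → l ≢ i → l ≢ j → l ≢ g → f l ≡ 0) →
            sum f ≤ f i + (f j + f g)
sum-three f i j g zeros = begin
  sum f                                            ≡⟨ sum-clear f i ⟩
  f i + sum f₁                                     ≡⟨ cong (f i +_) (sum-clear f₁ j) ⟩
  f i + (f₁ j + sum f₂)                            ≤⟨ +-monoʳ-≤ (f i) (+-mono-≤ (clear-≤ f i j) (≤-reflexive (sum-clear f₂ g))) ⟩
  f i + (f j + (f₂ g + sum (clear g f₂)))          ≡⟨ cong (λ z → f i + (f j + (f₂ g + z))) (sum-zero {f = clear g f₂} λ l →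
                                                        clear-zero {f = f₂} λ l≢g → clear-zero {f = f₁} λ l≢j →
                                                        clear-zero {f = f} λ l≢i → zeros l l≢i l≢j l≢g) ⟩
  f i + (f j + (f₂ g + 0))                         ≡⟨ cong (λ z → f i + (f j + z)) (+-identityʳ (f₂ g)) ⟩
  f i + (f j + f₂ g)                               ≤⟨ +-monoʳ-≤ (f i) (+-monoʳ-≤ (f j) (≤-trans (clear-≤ f₁ j g) (clear-≤ f i g))) ⟩
  f i + (f j + f g)                                ∎
  where
  open ≤-Reasoning
  f₁ = clear i f
  f₂ = clear j f₁

shrink : Fin t → Vector ℕ t → Vector ℕ t
shrink j r = updateAt r j pred

shrink-at : ∀ (r : Vector ℕ t) j → 0 < r j → r j ≡ suc (shrink j r j)
shrink-at r j rj = trans (sym (suc-pred (r j) ⦃ >-nonZero rj ⦄)) (cong suc (sym (updateAt-updates j r)))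

shrink-≤ : ∀ (r : Vector ℕ t) j l → shrink j r l ≤ r l
shrink-≤ r j l with l ≟ j
... | yes refl = ≤-trans (≤-reflexive (updateAt-updates j r)) pred[n]≤n
... | no l≢j   = ≤-reflexive (updateAt-minimal l j r l≢j)

sum-shrink : ∀ (r : Vector ℕ t) j → 0 < r j → sum r ≡ suc (sum (shrink j r))
sum-shrink r j rj = sum-adjust r (shrink j r) j (λ l l≢j → sym (updateAt-minimal l j r l≢j)) (shrink-at r j rj)

-- Fixing a wagon lowers the wagon count and the total capacity by one each, and no single capacity
-- grows.
shrink-spare : ∀ {r : Vector ℕ t} {j} → 0 < r j → Spare (suc k) r → Spare k (shrink j r)
shrink-spare {k = k} {r = r} {j} rj spare i = s≤s⁻¹
  (≤-trans (s≤s (+-monoʳ-≤ k (shrink-≤ r j i))) (≤-trans (spare i) (≤-reflexive (sum-shrink r j rj))))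

shrink-rich : ∀ {r : Vector ℕ t} {j} → 2 ≤ r j → Rich r → Rich (shrink j r)
shrink-rich {r = r} {j} rj rich i i′ with g , g≢i , g≢i′ , rg ← rich i i′ = g , g≢i , g≢i′ , positive
  where
  positive : 0 < shrink j r g
  positive with g ≟ j
  ... | yes refl = s≤s⁻¹ (subst (2 ≤_) (shrink-at r g (<⇒≤ rj)) rj)
  ... | no g≢j   = subst (0 <_) (sym (updateAt-minimal g j r g≢j)) rg

-- If every stack still awaiting a wagon has capacity 1 and at least three wagons
-- remain, the spare capacity provides a fourth usable stack.
crowded-rich : ∀ {Q : Stacks w t} {j} → Fits r Q → load Q ≡ suc k → 2 ≤ k → Spare (suc k) r → r j ≤ 1 →
               (∀ l → 2 ≤ r l → length (Q l) ≡ 0) → Rich (shrink j r)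
crowded-rich {r = r} {k = k} {Q = Q} {j} fits load≡ 2≤k spare rj≤1 unused i i′
  with any? (λ g → ¬? (g ≟ i) ×-dec ¬? (g ≟ i′) ×-dec ¬? (g ≟ j) ×-dec (0 <? r g))
... | yes (g , g≢i , g≢i′ , g≢j , rg) =
  g , g≢i , g≢i′ , subst (0 <_) (sym (updateAt-minimal g j r g≢j)) rg
-- Otherwise `i`, `i′` and `j` are the only usable stacks. The spare condition at `i′` and at `i`
-- then gives `k ≤ r i` and `k ≤ r i′`, so both await no wagon and all `suc k` wagons of `Q` sit in
-- stack `j`, of capacity at most one.
... | no none = contradiction (≤-trans (s≤s 2≤k) k≤1) λ { (s≤s ()) }
  where
  open ≤-Reasoning
  r≡0 : ∀ l → l ≢ i → l ≢ i′ → l ≢ j → r l ≡ 0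
  r≡0 l l≢i l≢i′ l≢j = n≤0⇒n≡0 (≮⇒≥ λ lt → none (l , l≢i , l≢i′ , l≢j , lt))
  total≤ : sum r ≤ r i + (r i′ + 1)
  total≤ = ≤-trans (sum-three r i i′ j r≡0) (+-monoʳ-≤ (r i) (+-monoʳ-≤ (r i′) rj≤1))
  2≤ri : 2 ≤ r i
  2≤ri = ≤-trans 2≤k (cancel-≤ (suc (r i′)) (≤-trans (spare i′) total≤)
    (+-suc k (r i′)) (cong (r i +_) (+-comm (r i′) 1)))
  2≤ri′ : 2 ≤ r i′
  2≤ri′ = ≤-trans 2≤k (cancel-≤ (suc (r i)) (≤-trans (spare i) total≤)
    (+-suc k (r i)) (solve 2 (λ a b → a :+ (b :+ con 1) := b :+ (con 1 :+ a)) refl (r i) (r i′)))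
  k≤1 : suc k ≤ 1
  k≤1 = begin
    suc k                                            ≡⟨ trans (sym load≡) (load≡sum-length Q) ⟩
    sum (length ∘ Q)                                 ≤⟨ sum-three (length ∘ Q) i i′ j (λ l l≢i l≢i′ l≢j →
                                                          n≤0⇒n≡0 (subst (length (Q l) ≤_) (r≡0 l l≢i l≢i′ l≢j) (fits l))) ⟩
    length (Q i) + (length (Q i′) + length (Q j))    ≡⟨ cong₂ (λ a b → a + (b + length (Q j))) (unused i 2≤ri) (unused i′ 2≤ri′) ⟩
    length (Q j)                                     ≤⟨ ≤-trans (fits j) rj≤1 ⟩
    1                                                ∎

-- A stack that `Q` uses and that has capacity at least two is preferred, since it remains usable
-- after shrinking. If there is none, `crowded-rich` applies unless at most one wagon will remain,
-- when any used stack serves.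
choose-stack : ∀ {r : Vector ℕ t} {Q : Stacks w t} → Fits r Q → load Q ≡ suc k → Feasible (suc k) r →
             ∃[ j ] (0 < length (Q j) × Feasible k (shrink j r))
choose-stack {Q = Q} fits load≡ (inj₁ (s≤s k≤0)) with j , Qj ← nonempty-stack Q load≡ =
  j , Qj , inj₁ (≤-trans k≤0 z≤n)
choose-stack {k = k} {r = r} {Q = Q} fits load≡ (inj₂ (spare , rich))
  with any? (λ j → (0 <? length (Q j)) ×-dec (2 ≤? r j))
... | yes (j , Qj , rj) = j , Qj , inj₂ (shrink-spare (<⇒≤ rj) spare , shrink-rich rj rich)
... | no none with j , Qj ← nonempty-stack Q load≡ with k ≤? 1
... | yes k≤1 = j , Qj , inj₁ k≤1
... | no  k≰1 = j , Qj , inj₂ (shrink-spare (≤-trans Qj (fits j)) spare ,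
  crowded-rich {Q = Q} fits load≡ (≰⇒> k≰1) spare (s≤s⁻¹ (≰⇒> λ 2≤rj → none (j , Qj , 2≤rj)))
    λ l 2≤rl → n≤0⇒n≡0 (≮⇒≥ λ Ql → none (l , Ql , 2≤rl)))

-- Rearranging all wagons

placementCost : ℕ → ℕ
placementCost 1 = 1
placementCost k = 2 * k + 5

-- For `w ≥ 1` the value at `w` is w² + 6w - 6. The last wagon costs one transfer instead of seven.
transferBudget : ℕ → ℕ
transferBudget 0       = 0
transferBudget (suc k) = placementCost (suc k) + transferBudget k

place-within : Feasible (suc k) r → ∀ {U : Stacks w t} {i x} → Tidy r (suc k) U → x ∈ U i → ∀ j → 0 < r j →
               Sunk r x j (placementCost (suc k)) U
place-within {k = zero}  _ T x∈ j rj = place-single (Tidy.loadₖ T) x∈ j rj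
place-within {k = suc k} (inj₁ (s≤s ())) T x∈ j rj
place-within {k = suc k} {r = r} (inj₂ (spare , rich)) T x∈ j rj = Placing.place r _ spare rich T x∈ j rj

unsink : ∀ (U : Stacks w t) {j x l} → U j ≡ l ∷ʳ x → U ≗ sink j x (updateAt U j (const l))
unsink U {j} {x} {l} Uj m =
  sym (trans (updateAt-updateAt-local j {h = const (l ∷ʳ x)} U refl m) (updateAt-id-local j U (sym Uj) m))

unsink-fits : ∀ {r : Vector ℕ t} {U : Stacks w t} {j x l} → Fits r U → U j ≡ l ∷ʳ x → Fits (shrink j r) (updateAt U j (const l))
unsink-fits {r = r} {U = U} {j} {x} {l} fits Uj m with m ≟ j
... | yes refl = begin
  length (updateAt U j (const l) j) ≡⟨ cong length (updateAt-updates j U) ⟩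
  length l                          ≤⟨ pred-mono-≤ (subst (_≤ r j) (trans (cong length Uj) (length-∷ʳ l x)) (fits j)) ⟩
  pred (r j)                        ≡⟨ updateAt-updates j r ⟨
  shrink j r j                      ∎
  where open ≤-Reasoning
... | no m≢j = subst₂ (λ l c → length l ≤ c) (sym (updateAt-minimal m j U m≢j)) (sym (updateAt-minimal m j r m≢j)) (fits m)

unsnoc-nonempty : ∀ (l : List (Fin w)) → 0 < length l → ∃₂ λ xs x → l ≡ xs ∷ʳ x
unsnoc-nonempty l nonempty with initLast l
... | xs ∷ʳ′ x = xs , x , refl
unsnoc-nonempty .[] () | []

-- Stacks are completed from the bottom. Once the bottom wagon of `Q j` is in place, it is deleted
-- from both sides with one unit of capacity, and `Reach-sink` lifts the recursive solution back.
rearrange : ∀ k {r : Vector ℕ t} {U Q : Stacks w t} → Fits r U → Fits r Q → (∀ φ → total φ U ≡ total φ Q) →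
            load Q ≡ k → Feasible k r → Reach r (transferBudget k) U Q
rearrange zero {U = U} {Q} fitsU fitsQ same load≡ _ = done λ l → trans (empty U (trans (same _) load≡) l) (sym (empty Q load≡ l))
  where
  empty : ∀ U → load U ≡ 0 → ∀ l → U l ≡ []
  empty U load≡ l with U l | subst (length (U l) ≤_) load≡ (length≤load U l)
  ... | [] | _ = refl
rearrange (suc k) {r} {U} {Q} fitsU fitsQ same load≡ feasible
  with j , Qj>0 , feasible⁻ ← choose-stack {Q = Q} fitsQ load≡ feasible
  with lq , x , Qj ← unsnoc-nonempty (Q j) Qj>0
  with i , x∈ ← locate {U = U} {Q = Q} same Qj
  with U′ , p , l , U′j ← place-within {r = r} feasible {U} (tidy fitsU (trans (same _) load≡)) x∈ j (≤-trans Qj>0 (fitsQ j)) =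
  p ◅◅ Reach-respˡ (unsink U′ U′j) (Reach-respʳ (Reach-sink j (shrink-at r j (≤-trans Qj>0 (fitsQ j))) (λ m m≢j → sym (updateAt-minimal m j r m≢j)) x
    (rearrange k (unsink-fits {U = U′} (Reach-fits {U = U} fitsU p) U′j) (unsink-fits {U = Q} fitsQ Qj) same⁻ load⁻ feasible⁻)) (λ m → sym (unsink Q Qj m)))
  where
  U⁻ = updateAt U′ j (const l)
  Q⁻ = updateAt Q j (const lq)
  drop-x : ∀ φ V {l} → V j ≡ l ∷ʳ x → total φ V ≡ φ x + total φ (updateAt V j (const l))
  drop-x φ V {l} Vj = trans (total-cong φ (unsink V Vj)) (total-sink φ j x (updateAt V j (const l)))
  same⁻ : ∀ φ → total φ U⁻ ≡ total φ Q⁻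
  same⁻ φ = +-cancelˡ-≡ (φ x) _ _ (trans (sym (drop-x φ U′ U′j)) (trans (sym (Reach-total φ p)) (trans (same φ) (drop-x φ Q Qj))))
  load⁻ : load Q⁻ ≡ k
  load⁻ = suc-injective (trans (sym (drop-x (const 1) Q Qj)) load≡)

-- Configurations, shunts and the passage to stacks

variable
  s h : ℕ
  m : Vec ℕ s

lookup-extensional : ∀ {A : Set} {xs ys : Vec A n} → (∀ i → lookup xs i ≡ lookup ys i) → xs ≡ ys
lookup-extensional {xs = xs} {ys} eq = trans (sym (tabulate∘lookup xs)) (trans (tabulate-cong eq) (tabulate∘lookup ys))

contents : Config w s → List (Fin w)
contents (W₀ , Ws) = W₀ ++ concat (toList Ws)

concat-extract : ∀ (Ws : Vec (List (Fin w)) s) r → concat (toList Ws) ↭ lookup Ws r ++ concat (toList (Ws [ r ]≔ []))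
concat-extract (W ∷ Ws) zero    = ↭-refl
concat-extract (W ∷ Ws) (suc r) = ↭-trans (++⁺ˡ W (concat-extract Ws r)) (shifts W (lookup Ws r))

-- The conditions of `Move` apart from being distinct positions, so that a shunt may be trivial and
-- can be studied before capacities are checked.
record Shunt {w s : ℕ} (c c′ : Config w s) : Set where
  constructor shunting
  field
    siding : Fin s
    others : ∀ i → i ≢ siding → lookup (proj₂ c) i ≡ lookup (proj₂ c′) i
    shunt  : proj₁ c ++ lookup (proj₂ c) siding ≡ proj₁ c′ ++ lookup (proj₂ c′) siding

Shunt-sym : ∀ {c c′ : Config w s} → Shunt c c′ → Shunt c′ c
Shunt-sym (shunting r others shunt) = shunting r (λ i i≢r → sym (others i i≢r)) (sym shunt)

-- With the headshunt and the shunted siding brought to the front, both contents begin with the same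
-- list and continue with the same untouched sidings.
Shunt-↭ : ∀ {c c′ : Config w s} → Shunt c c′ → contents c ↭ contents c′
Shunt-↭ {c = W₀ , Ws} {W₀′ , Ws′} (shunting r others shunt) =
  ↭-trans (gather W₀ Ws) (↭-trans (↭-reflexive (cong₂ (λ l Vs → l ++ concat (toList Vs)) shunt rest)) (↭-sym (gather W₀′ Ws′)))
  where
  gather : ∀ W₀ Ws → W₀ ++ concat (toList Ws) ↭ (W₀ ++ lookup Ws r) ++ concat (toList (Ws [ r ]≔ []))
  gather W₀ Ws = ↭-trans (++⁺ˡ W₀ (concat-extract Ws r)) (↭-reflexive (sym (++-assoc W₀ (lookup Ws r) _)))
  rest : Ws [ r ]≔ [] ≡ Ws′ [ r ]≔ []
  rest = lookup-extensional same
    where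
    same : ∀ i → lookup (Ws [ r ]≔ []) i ≡ lookup (Ws′ [ r ]≔ []) i
    same i with i ≟ r
    ... | yes refl = trans (lookup∘update i Ws []) (sym (lookup∘update i Ws′ []))
    ... | no i≢r   = trans (lookup∘update′ i≢r Ws []) (trans (others i i≢r) (sym (lookup∘update′ i≢r Ws′ [])))

-- The headshunt is a stack whose top is its last wagon, the one next to the points.
virtual : Config w s → Stacks w (suc s)
virtual (W₀ , Ws) zero    = reverse W₀
virtual (W₀ , Ws) (suc i) = lookup Ws i

actual : Stacks w (suc s) → Config w s
actual U = reverse (U zero) , tabulate (U ∘ suc)

actual-virtual : (c : Config w s) → actual (virtual c) ≡ c
actual-virtual (W₀ , Ws) = cong₂ _,_ (reverse-involutive W₀) (tabulate∘lookup Ws)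

actual-cong : {U U′ : Stacks w (suc s)} → U ≗ U′ → actual U ≡ actual U′
actual-cong eq = cong₂ _,_ (cong reverse (eq zero)) (tabulate-cong (eq ∘ suc))

caps : ℕ → Vec ℕ s → Vector ℕ (suc s)
caps h m zero    = h
caps h m (suc i) = lookup m i

actual-position : ∀ {U : Stacks w (suc s)} → Fits (caps h m) U → contents (actual U) ↭ allFin w → IsPosition h m (actual U)
actual-position {h = h} {m = m} {U = U} fits perm = mkPos perm
  (subst (_≤ h) (sym (length-reverse (U zero))) (fits zero))
  λ i → subst (λ l → length l ≤ lookup m i) (sym (lookup∘tabulate (U ∘ suc) i)) (fits (suc i))

virtual-fits : ∀ {c : Config w s} → IsPosition h m c → Fits (caps h m) (virtual c)
virtual-fits {h = h} {c = W₀ , _} p zero    = subst (_≤ h) (sym (length-reverse W₀)) (IsPosition.headCap p)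
virtual-fits                      p (suc i) = IsPosition.sidingCap p i

-- Drawing the top wagon of siding `i` to the points end of the headshunt leaves the headshunt
-- followed by that siding unchanged.
push-shunt : ∀ i x (V : Stacks w (suc s)) →
             actual (push i x V) ≡ actual (push zero x V) ⊎ Shunt (actual (push i x V)) (actual (push zero x V))
push-shunt zero    x V = inj₁ refl
push-shunt (suc i) x V = inj₂ (shunting i
  (λ l l≢i → trans (lookup∘tabulate _ l) (trans (updateAt-minimal l i (V ∘ suc) l≢i) (sym (lookup∘tabulate _ l))))
  (begin
    reverse (V zero) ++ lookup (tabulate (updateAt (V ∘ suc) i (x ∷_))) i  ≡⟨ cong (reverse (V zero) ++_) (trans (lookup∘tabulate _ i) (updateAt-updates i (V ∘ suc))) ⟩
    reverse (V zero) ++ x ∷ V (suc i)                                      ≡⟨ ++-assoc (reverse (V zero)) (x ∷ []) (V (suc i)) ⟨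
    (reverse (V zero) ∷ʳ x) ++ V (suc i)                                   ≡⟨ cong₂ _++_ (unfold-reverse x (V zero)) (lookup∘tabulate _ i) ⟨
    reverse (x ∷ V zero) ++ lookup (tabulate (V ∘ suc)) i                  ∎))
  where open ≡-Reasoning

-- Carrying out transfers by moves

PathUpTo : (h : ℕ) (m : Vec ℕ s) → ℕ → Config w s → Config w s → Set
PathUpTo h m b c c′ = ∃[ n ] (n ≤ b × Path h m n c c′)

infixr 5 _⨾_
_⨾_ : ∀ {c c′ c″ : Config w s} → PathUpTo h m a c c′ → PathUpTo h m b c′ c″ → PathUpTo h m (a + b) c c″
_⨾_ {b = b} (_ , le , p) (_ , le′ , q) = _ , +-mono-≤ le le′ , append p q
  where
  append : ∀ {w s h n n′} {m : Vec ℕ s} {c c′ c″ : Config w s} →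
           Path h m n c c′ → Path h m n′ c′ c″ → Path h m (n + n′) c c″
  append here        q = q
  append (there s p) q = there s (append p q)

stay : ∀ {c c′ : Config w s} → c ≡ c′ → PathUpTo h m b c c′
stay refl = 0 , z≤n , here

-- A `Move` joins distinct positions, so a trivial shunt has to become an empty path; this is why
-- path lengths are only bounded above.
Shunt-path : ∀ {c c′ : Config w s} → IsPosition h m c → IsPosition h m c′ → Shunt c c′ → PathUpTo h m 1 c c′
Shunt-path {c = c} {c′} p p′ (shunting r others shunt)
  with Product-≡-dec (List-≡-dec _≟_) (Vec-≡-dec (List-≡-dec _≟_)) c c′
... | yes c≡c′ = stay c≡c′
... | no  c≢c′ = 1 , ≤-refl , there (mkMove p p′ c≢c′ r others shunt) here

push-↭ : ∀ i j x (V : Stacks w (suc s)) → contents (actual (push i x V)) ↭ contents (actual (push j x V))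
push-↭ i j x V = ↭-trans (to-hub i) (↭-sym (to-hub j))
  where
  to-hub : ∀ i → contents (actual (push i x V)) ↭ contents (actual (push zero x V))
  to-hub i with push-shunt i x V
  ... | inj₁ eq = ↭-reflexive (cong contents eq)
  ... | inj₂ sh = Shunt-↭ sh

-- Entering and leaving the last slot of the headshunt, which the stack model keeps free.
push-path : ∀ i x (V : Stacks w (suc s)) → contents (actual (push i x V)) ↭ allFin w →
            Fits (caps h m) (push i x V) → Fits (caps h m) (push zero x V) →
            PathUpTo h m 1 (actual (push i x V)) (actual (push zero x V)) ×
            PathUpTo h m 1 (actual (push zero x V)) (actual (push i x V))
push-path i x V perm fits fits₀ with push-shunt i x V
... | inj₁ eq = stay eq , stay (sym eq)
... | inj₂ sh = Shunt-path p p₀ sh , Shunt-path p₀ p (Shunt-sym sh)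
  where
  p  = actual-position {U = push i x V} fits perm
  p₀ = actual-position {U = push zero x V} fits₀ (↭-trans (push-↭ zero i x V) perm)

caps-mono : ∀ h (m : Vec ℕ s) l → caps h m l ≤ caps (suc h) m l
caps-mono h m zero    = n≤1+n h
caps-mono h m (suc l) = ≤-refl

Fits-cong : ∀ {U U′ : Stacks w t} → U ≗ U′ → Fits r U → Fits r U′
Fits-cong {r = r} eq fits l = subst (λ z → length z ≤ r l) (eq l) (fits l)

-- The wagon goes from `i` to the points end of the headshunt and from there to `j`. The
-- intermediate position fits because the real headshunt has length `suc h` while the stack model
-- uses only `h` of it.
Transfer-path : ∀ {U U′ : Stacks w (suc s)} → contents (actual U) ↭ allFin w → Fits (caps h m) U →
                Transfer (caps h m) U U′ →
                PathUpTo (suc h) m 2 (actual U) (actual U′) × contents (actual U′) ↭ allFin w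
Transfer-path {h = h} {m = m} {U = U} {U′} perm fits s@(transfer i j x V from to room) =
  subst₂ (PathUpTo (suc h) m 2) (sym (actual-cong from)) (sym (actual-cong to))
    (proj₁ (push-path i x V perm-i (Fits-cong {U = U} from (widen {U} fits)) fits₀) ⨾
     proj₂ (push-path j x V perm-j (Fits-cong {U = U′} to (widen {U′} (Transfer-fits {U = U} {U′} fits s))) fits₀)) ,
  subst (λ c → contents c ↭ allFin _) (sym (actual-cong to)) perm-j
  where
  perm-i = subst (λ c → contents c ↭ allFin _) (actual-cong from) perm
  perm-j = ↭-trans (push-↭ j i x V) perm-i
  widen : ∀ {U} → Fits (caps h m) U → Fits (caps (suc h) m) U
  widen f l = ≤-trans (f l) (caps-mono h m l)
  V-fits : Fits (caps h m) V
  V-fits l = ≤-trans (push-length i x V l) (subst (λ z → length z ≤ caps h m l) (from l) (fits l))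
  fits₀ : Fits (caps (suc h) m) (push zero x V)
  fits₀ zero    = s≤s (V-fits zero)
  fits₀ (suc l) = V-fits (suc l)

Reach-path : ∀ {U U′ : Stacks w (suc s)} → contents (actual U) ↭ allFin w → Fits (caps h m) U →
             Reach (caps h m) b U U′ → PathUpTo (suc h) m (b * 2) (actual U) (actual U′)
Reach-path perm fits (done eq)   = stay (actual-cong eq)
Reach-path {U = U} perm fits (step {U′ = U₁} s p) with path , perm₁ ← Transfer-path perm fits s =
  path ⨾ Reach-path perm₁ (Transfer-fits {U = U} {U₁} fits s) p

-- Freeing the transit slot and joining two positions

sum-lookup : (m : Vec ℕ s) → sum (lookup m) ≡ Vec.sum m
sum-lookup []      = refl
sum-lookup (x ∷ m) = cong (x +_) (sum-lookup m)

weight-++ : ∀ (φ : Fin w → ℕ) xs ys → weight φ (xs ++ ys) ≡ weight φ xs + weight φ ys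
weight-++ φ xs ys = trans (cong sumₗ (map-++ φ xs ys)) (sum-++ (map φ xs) (map φ ys))

weight-↭ : ∀ (φ : Fin w → ℕ) {xs ys} → xs ↭ ys → weight φ xs ≡ weight φ ys
weight-↭ φ p = sum-↭ (map⁺ φ p)

total-contents : ∀ (φ : Fin w → ℕ) (U : Stacks w (suc s)) → total φ U ≡ weight φ (contents (actual U))
total-contents φ U = begin
  weight φ (U zero) + total φ (U ∘ suc)                     ≡⟨ cong₂ _+_ (weight-↭ φ (↭-sym (↭-reverse (U zero)))) (sidings (U ∘ suc)) ⟩
  weight φ (reverse (U zero)) + weight φ (concat (toList (tabulate (U ∘ suc)))) ≡⟨ weight-++ φ (reverse (U zero)) _ ⟨
  weight φ (contents (actual U))                            ∎
  where
  open ≡-Reasoning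
  sidings : ∀ {s} (V : Stacks _ s) → total φ V ≡ weight φ (concat (toList (tabulate V)))
  sidings {zero}  V = refl
  sidings {suc s} V = trans (cong (weight φ (V zero) +_) (sidings (V ∘ suc))) (sym (weight-++ φ (V zero) _))

load-position : ∀ {U : Stacks w (suc s)} → contents (actual U) ↭ allFin w → load U ≡ w
load-position {w = w} {U = U} perm = begin
  load U                                   ≡⟨ total-contents (const 1) U ⟩
  weight (const 1) (contents (actual U))   ≡⟨ weight-↭ (const 1) perm ⟩
  weight (const 1) (allFin w)              ≡⟨ weight-1≡length (allFin w) ⟩
  length (allFin w)                        ≡⟨ length-tabulate id ⟩
  w                                        ∎
  where
  open ≡-Reasoning

-- Both directions are kept: a starting position is left along the first path, and a finishing one
-- is entered along the second.
Cleared : (h : ℕ) (m : Vec ℕ s) → Config w s → Set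
Cleared h m c = ∃[ U ] (Fits (caps h m) U × contents (actual U) ↭ allFin _ ×
                        PathUpTo (suc h) m 1 c (actual U) × PathUpTo (suc h) m 1 (actual U) c)

-- A headshunt with more than `h` wagons is full. The total capacity exceeds the number of wagons,
-- so some siding then has room for the last wagon of the headshunt.
clear-headshunt : ∀ {c : Config w s} → w < suc h + Vec.sum m → IsPosition (suc h) m c → Cleared h m c
clear-headshunt {w = w} {h = h} {m = m} {c = c} room p with length (proj₁ c) ≤? h
... | yes le = virtual c , fits , subst (λ d → contents d ↭ _) (sym (actual-virtual c)) (IsPosition.partition p) ,
               stay (sym (actual-virtual c)) , stay (actual-virtual c)
  where
  fits : Fits (caps h m) (virtual c)
  fits zero    = subst (_≤ h) (sym (length-reverse (proj₁ c))) le
  fits (suc i) = virtual-fits p (suc i)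
... | no full = unload (virtual c zero) refl
  where
  S = virtual c
  perm : contents (actual S) ↭ allFin w
  perm = subst (λ d → contents d ↭ _) (sym (actual-virtual c)) (IsPosition.partition p)
  h<S₀ : h < length (S zero)
  h<S₀ = subst (h <_) (sym (length-reverse (proj₁ c))) (≰⇒> full)
  space : ∃[ i ] length (S (suc i)) < lookup m i
  space with any? (λ i → length (S (suc i)) <? lookup m i)
  ... | yes found = found
  ... | no  none  = contradiction room (≤⇒≯ (begin
    suc h + Vec.sum m                          ≡⟨ cong (suc h +_) (sum-lookup m) ⟨
    suc h + sum (lookup m)                     ≤⟨ +-mono-≤ h<S₀ (sum-mono-≤ λ i → ≮⇒≥ λ lt → none (i , lt)) ⟩
    sum (length ∘ S)                           ≡⟨ load≡sum-length S ⟨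
    load S                                     ≡⟨ load-position {U = S} perm ⟩
    w                                          ∎))
    where open ≤-Reasoning
  unload : ∀ l → S zero ≡ l → Cleared h m c
  unload [] S₀ = contradiction (subst (λ l → h < length l) S₀ h<S₀) λ ()
  unload (x ∷ l) S₀ with i , lt ← space =
    push (suc i) x V , fits , perm′ ,
    subst (λ d → PathUpTo (suc h) m 1 d (actual (push (suc i) x V))) V-actual (proj₂ paths) ,
    subst (PathUpTo (suc h) m 1 (actual (push (suc i) x V))) V-actual (proj₁ paths)
    where
    V : Stacks w _
    V = updateAt S zero (const l)
    from : S ≗ push zero x V
    from = pop-top {U = S} {zero} S₀
    V-actual : actual (push zero x V) ≡ c
    V-actual = trans (sym (actual-cong from)) (actual-virtual c)
    fits₀ : Fits (caps (suc h) m) (push zero x V)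
    fits₀ = Fits-cong {U = S} from (virtual-fits p)
    fits : Fits (caps h m) (push (suc i) x V)
    fits zero = s≤s⁻¹ (fits₀ zero)
    fits (suc j) with j ≟ i
    ... | yes refl = subst (λ z → length z ≤ lookup m j) (sym (updateAt-updates j (V ∘ suc))) lt
    ... | no j≢i   = subst (λ z → length z ≤ lookup m j) (sym (updateAt-minimal j i (V ∘ suc) j≢i)) (fits₀ (suc j))
    perm′ : contents (actual (push (suc i) x V)) ↭ allFin w
    perm′ = ↭-trans (push-↭ (suc i) zero x V) (subst (λ d → contents d ↭ allFin w) (actual-cong from) perm)
    paths = push-path {h = suc h} {m = m} (suc i) x V perm′ (λ l → ≤-trans (fits l) (caps-mono h m l)) fits₀

-- One move frees the transit slot at the start, two carry out each transfer, and one refills the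
-- slot at the end if necessary.
connected : ∀ {c c′ : Config w s} → w < suc h + Vec.sum m → Feasible w (caps h m) →
            IsPosition (suc h) m c → IsPosition (suc h) m c′ →
            PathUpTo (suc h) m (1 + (transferBudget w * 2 + 1)) c c′
connected {w = w} {h = h} {m = m} room feasible p q
  with U , fitsU , permU , c→U , _ ← clear-headshunt room p
  with Q , fitsQ , permQ , _ , Q→c′ ← clear-headshunt room q =
  c→U ⨾ Reach-path {U = U} {Q} permU fitsU (rearrange w {U = U} {Q} fitsU fitsQ same (load-position {U = Q} permQ) feasible) ⨾ Q→c′
  where
  same : ∀ φ → total φ U ≡ total φ Q
  same φ = trans (total-contents φ U) (trans (weight-↭ φ (↭-trans permU (↭-sym permQ))) (sym (total-contents φ Q)))

budget : ∀ v → 1 + (transferBudget (suc v) * 2 + 1) ≡ 2 * suc v * suc v + 12 * suc v ∸ 10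
budget v = trans (sym (m+n∸n≡m _ 10)) (cong (_∸ 10) (closed v))
  where
  -- The ten is added before the induction, so that no truncated subtraction has to be handled.
  closed : ∀ v → 1 + (transferBudget (suc v) * 2 + 1) + 10 ≡ 2 * suc v * suc v + 12 * suc v
  closed zero    = refl
  closed (suc v) = begin
    1 + ((2 * (2 + v) + 5 + B) * 2 + 1) + 10          ≡⟨ solve 2 (λ v b → con 1 :+ ((con 2 :* (con 2 :+ v) :+ con 5 :+ b) :* con 2 :+ con 1) :+ con 10
                                                          := con 2 :* (con 2 :* (con 2 :+ v) :+ con 5) :+ (con 1 :+ (b :* con 2 :+ con 1) :+ con 10)) refl v B ⟩
    2 * (2 * (2 + v) + 5) + (1 + (B * 2 + 1) + 10)    ≡⟨ cong (2 * (2 * (2 + v) + 5) +_) (closed v) ⟩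
    2 * (2 * (2 + v) + 5) + (2 * suc v * suc v + 12 * suc v)
      ≡⟨ solve 1 (λ v → con 2 :* (con 2 :* (con 2 :+ v) :+ con 5) :+ (con 2 :* (con 1 :+ v) :* (con 1 :+ v) :+ con 12 :* (con 1 :+ v))
           := con 2 :* (con 2 :+ v) :* (con 2 :+ v) :+ con 12 :* (con 2 :+ v)) refl v ⟩
    2 * suc (suc v) * suc (suc v) + 12 * suc (suc v)  ∎
    where
    open ≡-Reasoning
    B = transferBudget (suc v)

-- Ends of lists and counting in positions

variable
  A : Set

last-++ : ∀ (xs : List A) y ys → last (xs ++ y ∷ ys) ≡ last (y ∷ ys)
last-++ []            y ys = refl
last-++ (x ∷ [])      y ys = refl
last-++ (x ∷ z ∷ xs)  y ys = last-++ (z ∷ xs) y ys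

last-++-just : ∀ (xs : List A) {ys y} → last ys ≡ just y → last (xs ++ ys) ≡ just y
last-++-just xs {z ∷ ys} eq = trans (last-++ xs z ys) eq

last-∈ : ∀ {x : A} xs → last xs ≡ just x → x ∈ xs
last-∈ (y ∷ [])     refl = here refl
last-∈ (y ∷ z ∷ xs) eq   = there (last-∈ (z ∷ xs) eq)

head-∈ : ∀ {x : A} xs → head xs ≡ just x → x ∈ xs
head-∈ (x ∷ xs) refl = here refl

last-nothing : ∀ (xs : List A) → last xs ≡ nothing → xs ≡ []
last-nothing []           eq = refl
last-nothing (x ∷ y ∷ xs) eq = contradiction (last-nothing (y ∷ xs) eq) λ ()

last≡head-reverse : ∀ (xs : List A) {x} → last xs ≡ just x → ∃[ ys ] reverse xs ≡ x ∷ ys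
last≡head-reverse xs eq with initLast xs
... | ys ∷ʳ′ y with refl ← just-injective (trans (sym (last-++ ys y [])) eq) = reverse ys , reverse-++ ys (y ∷ [])

prefix-unique : ∀ (xs ys : List A) {xs′ ys′} → length xs ≡ length ys → xs ++ xs′ ≡ ys ++ ys′ → xs ≡ ys
prefix-unique []       []       len eq = refl
prefix-unique (x ∷ xs) (y ∷ ys) len eq =
  cong₂ _∷_ (∷-injectiveˡ eq) (prefix-unique xs ys (cong pred len) (∷-injectiveʳ eq))

indicator-sum : ∀ (x : Fin n) → sumₗ (tabulateₗ (indicator x)) ≡ 1
indicator-sum {suc n} zero = cong suc (zeros n)
  where
  zeros : ∀ n → sumₗ (tabulateₗ {n = n} (λ i → indicator zero (suc i))) ≡ 0
  zeros zero    = refl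
  zeros (suc n) = zeros n
indicator-sum (suc x) = indicator-sum x

indicator-∈ : ∀ {x : Fin w} {l} → x ∈ l → 1 ≤ weight (indicator x) l
indicator-∈ {x = x} (here refl) = ≤-trans (≤-reflexive (sym (indicator-refl x))) (m≤m+n _ _)
indicator-∈ (there x∈)          = ≤-trans (indicator-∈ x∈) (m≤n+m _ _)

virtual-load : ∀ {c : Config w s} → IsPosition h m c → sum (length ∘ virtual c) ≡ w
virtual-load {c = c} p = trans (sym (load≡sum-length (virtual c)))
  (load-position {U = virtual c} (subst (λ d → contents d ↭ _) (sym (actual-virtual c)) (IsPosition.partition p)))

not-in-two : ∀ {c : Config w s} {x} → IsPosition h m c → ∀ i j → i ≢ j → x ∈ virtual c i → x ∈ virtual c j → ⊥
not-in-two {w = w} {c = c} {x} p i j i≢j x∈i x∈j = contradiction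
  (begin
    2                          ≤⟨ +-mono-≤ (indicator-∈ x∈j) (≤-trans (indicator-∈ x∈i) (≤-reflexive (sym (updateAt-minimal i j f i≢j)))) ⟩
    f j + clear j f i          ≤⟨ +-monoʳ-≤ (f j) (lookup≤sum (clear j f) i) ⟩
    f j + sum (clear j f)      ≡⟨ sum-clear f j ⟨
    total (indicator x) (virtual c)                      ≡⟨ total-contents (indicator x) (virtual c) ⟩
    weight (indicator x) (contents (actual (virtual c))) ≡⟨ cong (weight (indicator x) ∘ contents) (actual-virtual c) ⟩
    weight (indicator x) (contents c)                    ≡⟨ weight-↭ (indicator x) (IsPosition.partition p) ⟩
    weight (indicator x) (allFin w)                      ≡⟨ cong sumₗ (map-tabulate id (indicator x)) ⟩
    sumₗ (tabulateₗ (indicator x))                       ≡⟨ indicator-sum x ⟩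
    1                                                    ∎)
  λ { (s≤s ()) }
  where
  open ≤-Reasoning
  f = weight (indicator x) ∘ virtual c

-- Away from `i` the capacities add up to at most the amount stored there, and no entry of `a`
-- exceeds its capacity, so every one of them is reached.
full-elsewhere : ∀ {r a : Vector ℕ n} i → (∀ l → a l ≤ r l) → a i ≡ 0 → sum r ≤ sum a + r i →
                 ∀ l → l ≢ i → r l ≤ a l
full-elsewhere {r = r} {a} i a≤r ai≡0 tight l l≢i = cancel-≤ (sum a + r i)
  (begin
    sum a + r l + r i             ≡⟨ cong (λ z → sum a + z + r i) (updateAt-minimal l i r l≢i) ⟨
    sum a + clear i r l + r i     ≤⟨ +-monoˡ-≤ (r i) (sum-exchange a (clear i r) l λ k _ → below k) ⟩
    sum (clear i r) + a l + r i   ≡⟨ solve 3 (λ x y z → x :+ y :+ z := z :+ x :+ y) refl (sum (clear i r)) (a l) (r i) ⟩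
    r i + sum (clear i r) + a l   ≡⟨ cong (_+ a l) (sum-clear r i) ⟨
    sum r + a l                   ≤⟨ +-monoˡ-≤ (a l) tight ⟩
    sum a + r i + a l             ∎)
  (solve 3 (λ x y z → z :+ (x :+ y) := x :+ z :+ y) refl (sum a) (r i) (r l))
  (+-comm (sum a + r i) (a l))
  where
  open ≤-Reasoning
  below : ∀ k → a k ≤ clear i r k
  below k with k ≟ i
  ... | yes refl = ≤-trans (≤-reflexive ai≡0) z≤n
  ... | no k≢i   = ≤-trans (a≤r k) (≤-reflexive (sym (updateAt-minimal k i r k≢i)))

transpose-first : ∀ (x y : Fin n) → transpose x y ⟨$⟩ʳ x ≡ y
transpose-first x y with x ≟ x
... | yes _  = refl
... | no x≢x = contradiction refl x≢x

another : 2 ≤ n → (x : Fin n) → ∃[ y ] y ≢ x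
another (s≤s (s≤s _)) zero    = suc zero , λ ()
another (s≤s (s≤s _)) (suc x) = zero , λ ()

rich-three : ∀ {r : Vector ℕ t} i j g → i ≢ j → i ≢ g → j ≢ g → 0 < r i → 0 < r j → 0 < r g → Rich r
rich-three {r = r} i j g i≢j i≢g j≢g ri rj rg a b
  with any? (λ l → ¬? (l ≟ a) ×-dec ¬? (l ≟ b) ×-dec (0 <? r l))
... | yes found = found
... | no  none  = ⊥-elim (clash (hit i ri) (hit j rj) (hit g rg))
  where
  hit : ∀ l → 0 < r l → l ≡ a ⊎ l ≡ b
  hit l rl with l ≟ a | l ≟ b
  ... | yes l≡a | _       = inj₁ l≡a
  ... | no  _   | yes l≡b = inj₂ l≡b
  ... | no  l≢a | no l≢b  = contradiction (l , l≢a , l≢b , rl) none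
  clash : i ≡ a ⊎ i ≡ b → j ≡ a ⊎ j ≡ b → g ≡ a ⊎ g ≡ b → ⊥
  clash (inj₁ p) (inj₁ q) _        = i≢j (trans p (sym q))
  clash (inj₂ p) (inj₂ q) _        = i≢j (trans p (sym q))
  clash (inj₁ p) (inj₂ q) (inj₁ o) = i≢g (trans p (sym o))
  clash (inj₁ p) (inj₂ q) (inj₂ o) = j≢g (trans q (sym o))
  clash (inj₂ p) (inj₁ q) (inj₁ o) = j≢g (trans q (sym o))
  clash (inj₂ p) (inj₁ q) (inj₂ o) = i≢g (trans p (sym o))

-- Wagons unchanged by every move

record Invariant {w s : ℕ} (h : ℕ) (m : Vec ℕ s) : Set where
  field
    wagon       : Config w s → Maybe (Fin w)
    invariant   : ∀ {c c′} → Move h m c c′ → wagon c ≡ wagon c′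
    equivariant : ∀ π c → wagon (permuteConfig π c) ≡ Maybe.map (π ⟨$⟩ʳ_) (wagon c)

  along-path : ∀ {n c c′} → Path h m n c c′ → wagon c ≡ wagon c′
  along-path here        = refl
  along-path (there μ q) = trans (invariant μ) (along-path q)

-- A shunt at `i` keeps W₀ followed by Wᵢ. A shunt elsewhere keeps Wᵢ, which ends the list if it is
-- nonempty; if it is empty, `blocked` keeps W₀.
last-of-headshunt-and-siding : ∀ (i : Fin s) →
  (∀ {c c′ : Config w s} (μ : Move h m c c′) → Move.r μ ≢ i → lookup (proj₂ c) i ≡ [] → proj₁ c ≡ proj₁ c′) →
  Invariant {w} h m
last-of-headshunt-and-siding {s = s} {w = w} {h = h} {m = m} i blocked = record
  { wagon       = key
  ; invariant   = inv
  ; equivariant = λ { π (W₀ , Ws) → trans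
      (cong last (trans (cong (map (π ⟨$⟩ʳ_) W₀ ++_) (lookup-map i _ Ws)) (sym (map-++ (π ⟨$⟩ʳ_) W₀ (lookup Ws i)))))
      (last-map _ (W₀ ++ lookup Ws i)) }
  }
  where
  key : Config w s → Maybe (Fin w)
  key (W₀ , Ws) = last (W₀ ++ lookup Ws i)
  inv : ∀ {c c′} → Move h m c c′ → key c ≡ key c′
  inv {W₀ , Ws} {W₀′ , Ws′} μ with i ≟ Move.r μ
  ... | yes refl = cong last (Move.shunt μ)
  ... | no i≢r with Move.others μ i i≢r | lookup Ws i in Wi
  ...   | same | []    = cong₂ (λ a b → last (a ++ b)) (blocked μ (i≢r ∘ sym) Wi) (trans (sym Wi) same)
  ...   | same | x ∷ l = trans (last-++ W₀ x l) (trans (sym (last-++ W₀′ x l)) (cong (last ∘ (W₀′ ++_)) (trans (sym Wi) same)))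

nonempty-headshunt : ∀ {c : Config w s} → Vec.sum m < w → IsPosition h m c → ∃₂ λ x l → proj₁ c ≡ x ∷ l
nonempty-headshunt {c = x ∷ l , Ws} _ p = x , l , refl
nonempty-headshunt {w = w} {m = m} {c = [] , Ws} over p = contradiction over (≤⇒≯ (begin
  w                           ≡⟨ virtual-load p ⟨
  sum (length ∘ lookup Ws)    ≤⟨ sum-mono-≤ (IsPosition.sidingCap p) ⟩
  sum (lookup m)              ≡⟨ sum-lookup m ⟩
  Vec.sum m                   ∎))
  where open ≤-Reasoning

-- The sidings cannot hold all wagons, so the headshunt is never empty and the wagon next to the
-- engine never leaves.
first-of-headshunt : Vec.sum m < w → Invariant {w} h m
first-of-headshunt {m = m} {w = w} {h = h} over = record
  { wagon       = head ∘ proj₁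
  ; invariant   = inv
  ; equivariant = λ π c → head-map (proj₁ c)
  }
  where
  inv : ∀ {c c′} → Move h m c c′ → head (proj₁ c) ≡ head (proj₁ c′)
  inv {c} {c′} μ with nonempty-headshunt {c = c} over (Move.pos μ) | nonempty-headshunt {c = c′} over (Move.pos' μ)
  ... | x , l , refl | y , l′ , refl = cong just (∷-injectiveˡ (Move.shunt μ))

reverse-short : ∀ (l : List (Fin w)) → length l ≤ 1 → reverse l ≡ l
reverse-short []          le       = refl
reverse-short (x ∷ [])    le       = refl
reverse-short (x ∷ y ∷ l) (s≤s ())

-- With two sidings and room for one wagon in the headshunt, the layout is a single line of track.
first-on-line : ∀ {m : Vec ℕ s} (z o : Fin s) → z ≢ o → (∀ r → r ≡ z ⊎ r ≡ o) → Invariant {w} 1 m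
first-on-line {s = s} {w = w} {m = m} z o z≢o only = record
  { wagon       = head ∘ line
  ; invariant   = λ μ → cong head (inv μ)
  ; equivariant = λ { π (W₀ , Ws) → trans (cong head (equiv π W₀ Ws)) (head-map (line (W₀ , Ws))) }
  }
  where
  line : Config w s → List (Fin w)
  line (W₀ , Ws) = reverse (lookup Ws z) ++ W₀ ++ lookup Ws o
  fold : ∀ W₀ Wz → length W₀ ≤ 1 → reverse Wz ++ W₀ ≡ reverse (W₀ ++ Wz)
  fold W₀ Wz le = trans (cong (reverse Wz ++_) (sym (reverse-short W₀ le))) (sym (reverse-++ W₀ Wz))
  inv : ∀ {c c′} → Move 1 m c c′ → line c ≡ line c′
  inv {W₀ , Ws} {W₀′ , Ws′} (mkMove p p′ _ r others shunt) with only r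
  ... | inj₂ refl = cong₂ _++_ (cong reverse (others z z≢o)) shunt
  ... | inj₁ refl = begin
    reverse (lookup Ws z) ++ W₀ ++ lookup Ws o        ≡⟨ ++-assoc (reverse (lookup Ws z)) W₀ _ ⟨
    (reverse (lookup Ws z) ++ W₀) ++ lookup Ws o      ≡⟨ cong₂ _++_ ends (others o (z≢o ∘ sym)) ⟩
    (reverse (lookup Ws′ z) ++ W₀′) ++ lookup Ws′ o   ≡⟨ ++-assoc (reverse (lookup Ws′ z)) W₀′ _ ⟩
    reverse (lookup Ws′ z) ++ W₀′ ++ lookup Ws′ o     ∎
    where
    open ≡-Reasoning
    ends = trans (fold W₀ _ (IsPosition.headCap p)) (trans (cong reverse shunt) (sym (fold W₀′ _ (IsPosition.headCap p′))))
  equiv : ∀ π W₀ Ws → line (permuteConfig π (W₀ , Ws)) ≡ map (π ⟨$⟩ʳ_) (line (W₀ , Ws))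
  equiv π W₀ Ws = begin
    reverse (lookup (Vec.map f Ws) z) ++ map g W₀ ++ lookup (Vec.map f Ws) o
      ≡⟨ cong₂ (λ a b → reverse a ++ map g W₀ ++ b) (lookup-map z f Ws) (lookup-map o f Ws) ⟩
    reverse (f (lookup Ws z)) ++ map g W₀ ++ f (lookup Ws o)
      ≡⟨ cong₂ _++_ (reverse-map g (lookup Ws z)) (map-++ g W₀ (lookup Ws o)) ⟨
    map g (reverse (lookup Ws z)) ++ map g (W₀ ++ lookup Ws o)
      ≡⟨ map-++ g (reverse (lookup Ws z)) _ ⟨
    map g (line (W₀ , Ws)) ∎
    where
    open ≡-Reasoning
    g = π ⟨$⟩ʳ_
    f = map g

-- Necessity of the feasibility conditions

module Necessity {w s h : ℕ} {m : Vec ℕ s} (layout : ValidLayout w s h m) {P : Puzzle w s h m} (natural : Natural P)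
                 (solvable : AlwaysSolvable P) {p : Config w s} (start : Start P p) (2≤w : 2 ≤ w) where
  open Natural natural
  open ValidLayout layout

  Ends : Config w s → Set
  Ends q = IsPosition h m q × last (lookup (proj₂ q) z) ≡ just ω

  -- Naturality lets any wagon of p play the role of ω.
  outcome : ∀ (K : Invariant {w} h m) x →
            ∃[ q ] (Ends q × Invariant.wagon K q ≡ Maybe.map (transpose x ω ⟨$⟩ʳ_) (Invariant.wagon K p))
  outcome K x with _ , q , finished , path ← solvable _ (startClosed (transpose x ω) p start) =
    q , (finishPos P q finished , lastIsω q finished) ,
    trans (sym (Invariant.along-path K path)) (Invariant.equivariant K (transpose x ω) p)

  reaches-ω : ∀ (K : Invariant {w} h m) {x} → Invariant.wagon K p ≡ just x → ∃[ q ] (Ends q × Invariant.wagon K q ≡ just ω)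
  reaches-ω K {x} eq with q , ends , wq ← outcome K x =
    q , ends , trans wq (trans (cong (Maybe.map _) eq) (cong just (transpose-first x ω)))

  -- Solving from `p` shows that its invariant wagon is `ω`. Swapping `ω` with some `y` and solving
  -- again shows that the swap fixes `ω`, although it sends `y` there.
  determines-ω : ∀ (K : Invariant {w} h m) → (∀ q → Ends q → Invariant.wagon K q ≡ just ω) → ⊥
  determines-ω K always
    with _ , q , finished , path ← solvable p start
    with y , y≢ω ← another 2≤w ω
    with q′ , ends′ , wq′ ← outcome K y = y≢ω (begin
      y                    ≡⟨ inverseˡ π ⟨
      π ⟨$⟩ˡ (π ⟨$⟩ʳ y)    ≡⟨ cong (π ⟨$⟩ˡ_) (trans (transpose-first y ω) (sym fixed)) ⟩
      π ⟨$⟩ˡ (π ⟨$⟩ʳ ω)    ≡⟨ inverseˡ π ⟩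
      ω                    ∎)
    where
    open ≡-Reasoning
    π = transpose y ω
    wp : Invariant.wagon K p ≡ just ω
    wp = trans (Invariant.along-path K path) (always q (finishPos P q finished , lastIsω q finished))
    fixed : π ⟨$⟩ʳ ω ≡ ω
    fixed = just-injective (trans (cong (Maybe.map (π ⟨$⟩ʳ_)) (sym wp)) (trans (sym wq′) (always q′ ends′)))

  end-∈ : ∀ {q} → Ends q → ω ∈ virtual q (suc z)
  end-∈ (_ , eq) = last-∈ _ eq

  module _ (i : Fin s) (tight : h + Vec.sum m ≤ w + lookup m i) where

    -- With siding `i` empty, its capacity already accounts for all the spare capacity, so every
    -- other place is full.
    headshunt-full : ∀ {c} → IsPosition h m c → lookup (proj₂ c) i ≡ [] → h ≤ length (proj₁ c)
    headshunt-full {c} pos Wi = subst (h ≤_) (length-reverse (proj₁ c))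
      (full-elsewhere (suc i) (virtual-fits pos) (cong length Wi)
        (subst₂ (λ a b → h + a ≤ b + lookup m i) (sym (sum-lookup m)) (sym (virtual-load pos)) tight) zero λ ())

    -- A shunt at another siding with `i` empty joins two full headshunts, which are prefixes of
    -- equal length of the same list and hence equal.
    last-wagon : Invariant {w} h m
    last-wagon = last-of-headshunt-and-siding i λ
      { {c} {c′} (mkMove pos pos′ _ r others shunt) r≢i Wi → prefix-unique (proj₁ c) (proj₁ c′)
          (trans (≤-antisym (IsPosition.headCap pos) (headshunt-full pos Wi))
                 (≤-antisym (headshunt-full pos′ (trans (sym (others i (r≢i ∘ sym))) Wi)) (IsPosition.headCap pos′)))
          shunt }

    -- The invariant wagon lies in the headshunt or in siding `i`. If `i` is `z`, it is always `ω`
    -- at the finish; otherwise, relabelled as `ω`, it would also lie in siding `z`.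
    not-tight : ⊥
    not-tight with i ≟ z
    ... | yes refl = determines-ω last-wagon λ { (W₀ , Ws) (_ , eq) → last-++-just W₀ eq }
    ... | no i≢z with last (proj₁ p ++ lookup (proj₂ p) i) in eq
    -- Without an invariant wagon the headshunt and siding `i` would both be empty, yet
    -- `headshunt-full` fills a headshunt of positive length.
    ...   | nothing = contradiction h-pos (≤⇒≯ (≤-trans (headshunt-full (startPos P p start) (++-conicalʳ (proj₁ p) _ empty))
                                                         (≤-reflexive (cong length (++-conicalˡ (proj₁ p) _ empty)))))
      where empty = last-nothing _ eq
    ...   | just x with (W₀ , Ws) , ends , eq′ ← reaches-ω last-wagon eq with ∈-++⁻ W₀ (last-∈ (W₀ ++ lookup Ws i) eq′)
    ...     | inj₁ ω∈ = not-in-two (proj₁ ends) zero (suc z) (λ ()) (∈-resp-↭ (↭-sym (↭-reverse W₀)) ω∈) (end-∈ ends)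
    ...     | inj₂ ω∈ = not-in-two (proj₁ ends) (suc i) (suc z) (i≢z ∘ Fin-suc-injective) ω∈ (end-∈ ends)

  -- Otherwise the first wagon of the headshunt, relabelled `ω`, would stay there and yet end in
  -- siding `z`. The bound is the `Spare` condition at the headshunt stack.
  sidings-hold-all : w ≤ Vec.sum m
  sidings-hold-all = ≮⇒≥ impossible
    where
    impossible : ¬ Vec.sum m < w
    impossible over
      with x , l , eq ← nonempty-headshunt over (startPos P p start)
      with (W₀ , Ws) , ends , eq′ ← reaches-ω (first-of-headshunt over) (cong head eq) =
      not-in-two (proj₁ ends) zero (suc z) (λ ()) (∈-resp-↭ (↭-sym (↭-reverse W₀)) (head-∈ W₀ eq′)) (end-∈ ends)

  sidings-spare : ∀ i → w + lookup m i < h + Vec.sum m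
  sidings-spare i = ≰⇒> (not-tight i)

  single-siding : (∀ r → r ≡ z) → ⊥
  single-siding only = determines-ω
    (last-of-headshunt-and-siding z λ μ r≢z _ → contradiction (only (Move.r μ)) r≢z)
    λ { (W₀ , Ws) (_ , eq) → last-++-just W₀ eq }

  -- The line starts with siding `z` read from its buffer stop, where every finishing position has
  -- `ω`.
  single-line : h ≡ 1 → ∀ o → z ≢ o → (∀ r → r ≡ z ⊎ r ≡ o) → ⊥
  single-line refl o z≢o only = determines-ω (first-on-line z o z≢o only) λ
    { (W₀ , Ws) (_ , eq) → cong (λ l → head (l ++ W₀ ++ lookup Ws o)) (proj₂ (last≡head-reverse (lookup Ws z) eq)) }

feasible : ∀ {w s h} {m : Vec ℕ s} → ValidLayout w s (suc h) m → {P : Puzzle w s (suc h) m} → Natural P →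
           AlwaysSolvable P → ∀ {p} → Start P p → Feasible w (caps h m)
feasible {w} {s} {h} {m} layout {P} natural solvable start with w ≤? 1
... | yes w≤1 = inj₁ w≤1
... | no  w≰1 = inj₂ (spare , rich h m layout (Natural.z natural) single-siding single-line)
  where
  open Necessity layout natural solvable start (≰⇒> w≰1)
  spare : Spare w (caps h m)
  spare zero    = begin
    w + h                 ≡⟨ +-comm w h ⟩
    h + w                 ≤⟨ +-monoʳ-≤ h sidings-hold-all ⟩
    h + Vec.sum m         ≡⟨ cong (h +_) (sum-lookup m) ⟨
    sum (caps h m)        ∎
    where open ≤-Reasoning
  -- The strict inequality for the headshunt of length `suc h` is the weak one for the stack of
  -- capacity `h`.
  spare (suc i) = ≤-trans (s≤s⁻¹ (sidings-spare i)) (≤-reflexive (cong (h +_) (sym (sum-lookup m))))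
  -- Three sidings suffice by themselves; with two, the headshunt stack is the third unless its
  -- capacity is zero. One siding and a single line are the excluded cases.
  rich : ∀ h {s} (m : Vec ℕ s) → ValidLayout w s (suc h) m → ∀ (z : Fin s) → ¬ (∀ r → r ≡ z) →
         (suc h ≡ 1 → ∀ o → z ≢ o → ¬ (∀ r → r ≡ z ⊎ r ≡ o)) → Rich (caps h m)
  rich _ (_ ∷ []) _ zero single _ = contradiction (λ { zero → refl }) single
  rich _ (_ ∷ _ ∷ _ ∷ _) layout _ _ _ = rich-three (suc zero) (suc (suc zero)) (suc (suc (suc zero))) (λ ()) (λ ()) (λ ())
    (positive zero) (positive (suc zero)) (positive (suc (suc zero)))
    where positive = ValidLayout.m-pos layout
  rich (suc _) (_ ∷ _ ∷ []) layout _ _ _ = rich-three zero (suc zero) (suc (suc zero)) (λ ()) (λ ()) (λ ())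
    (s≤s z≤n) (ValidLayout.m-pos layout zero) (ValidLayout.m-pos layout (suc zero))
  rich zero (_ ∷ _ ∷ []) _ zero _ line =
    contradiction (λ { zero → inj₁ refl ; (suc zero) → inj₂ refl }) (line refl (suc zero) λ ())
  rich zero (_ ∷ _ ∷ []) _ (suc zero) _ line =
    contradiction (λ { zero → inj₂ refl ; (suc zero) → inj₁ refl }) (line refl zero λ ())

-- Relabelling positions

map-allFin-↭ : (π : Permutation′ w) → map (π ⟨$⟩ʳ_) (allFin w) ↭ allFin w
map-allFin-↭ {w} π = ∼bag⇒↭ (unique∧set⇒bag
  (Unique.map⁺ (λ {x} {y} eq → trans (sym (inverseˡ π)) (trans (cong (π ⟨$⟩ˡ_) eq) (inverseˡ π))) (Unique.allFin⁺ w))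
  (Unique.allFin⁺ w)
  (mk⇔ (λ _ → ∈-allFin _) (λ _ → subst (_∈ map (π ⟨$⟩ʳ_) (allFin w)) (inverseʳ π) (∈-map⁺ (π ⟨$⟩ʳ_) (∈-allFin _)))))

contents-permute : ∀ (π : Permutation′ w) (c : Config w s) → contents (permuteConfig π c) ≡ map (π ⟨$⟩ʳ_) (contents c)
contents-permute π (W₀ , Ws) = begin
  map f W₀ ++ concat (toList (Vec.map (map f) Ws))   ≡⟨ cong (λ l → map f W₀ ++ concat l) (toList-map (map f) Ws) ⟩
  map f W₀ ++ concat (map (map f) (toList Ws))       ≡⟨ cong (map f W₀ ++_) (concat-map (toList Ws)) ⟩
  map f W₀ ++ map f (concat (toList Ws))             ≡⟨ map-++ f W₀ _ ⟨
  map f (W₀ ++ concat (toList Ws))                   ∎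
  where
  open ≡-Reasoning
  f = π ⟨$⟩ʳ_

permute-position : ∀ {m : Vec ℕ s} (π : Permutation′ w) c → IsPosition h m c → IsPosition h m (permuteConfig π c)
permute-position {h = h} {m = m} π c@(W₀ , Ws) (mkPos partition headCap sidingCap) = mkPos
  (↭-trans (↭-reflexive (contents-permute π c)) (↭-trans (map⁺ _ partition) (map-allFin-↭ π)))
  (subst (_≤ h) (sym (length-map _ W₀)) headCap)
  λ i → subst (_≤ lookup m i) (sym (trans (cong length (lookup-map i _ Ws)) (length-map _ (lookup Ws i)))) (sidingCap i)

-- Ascents and the potential

less : Fin w → Fin w → ℕ
less x y = if toℕ x <ᵇ toℕ y then 1 else 0

-- All pairs in increasing order are counted, not only adjacent ones, so this is the number of
-- non-inversions.
ascents : List (Fin w) → ℕ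
ascents []      = 0
ascents (x ∷ l) = weight (less x) l + ascents l

less≤1 : ∀ (x y : Fin w) → less x y ≤ 1
less≤1 x y with toℕ x <ᵇ toℕ y
... | true  = ≤-refl
... | false = z≤n

-- Exchanging two neighbours affects no pair but their own.
ascents-swap : ∀ (A : List (Fin w)) x y B → ascents (A ++ x ∷ y ∷ B) ≤ suc (ascents (A ++ y ∷ x ∷ B))
ascents-swap [] x y B = begin
  less x y + X + (Y + ascents B)       ≤⟨ +-monoˡ-≤ (Y + ascents B) (+-monoˡ-≤ X (less≤1 x y)) ⟩
  1 + X + (Y + ascents B)              ≡⟨ solve 3 (λ x y b → con 1 :+ x :+ (y :+ b) := con 1 :+ (y :+ (x :+ b))) refl X Y (ascents B) ⟩
  suc (Y + (X + ascents B))            ≤⟨ s≤s (+-monoˡ-≤ (X + ascents B) (m≤n+m Y (less y x))) ⟩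
  suc (less y x + Y + (X + ascents B)) ∎
  where
  open ≤-Reasoning
  X = weight (less x) B
  Y = weight (less y) B
ascents-swap (z ∷ A) x y B = begin
  weight (less z) (A ++ x ∷ y ∷ B) + ascents (A ++ x ∷ y ∷ B)       ≡⟨ cong (_+ ascents (A ++ x ∷ y ∷ B)) (weight-↭ (less z) (++⁺ˡ A (swap x y ↭-refl))) ⟩
  weight (less z) (A ++ y ∷ x ∷ B) + ascents (A ++ x ∷ y ∷ B)       ≤⟨ +-monoʳ-≤ _ (ascents-swap A x y B) ⟩
  weight (less z) (A ++ y ∷ x ∷ B) + suc (ascents (A ++ y ∷ x ∷ B)) ≡⟨ +-suc _ _ ⟩
  suc (weight (less z) (A ++ y ∷ x ∷ B) + ascents (A ++ y ∷ x ∷ B)) ∎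
  where open ≤-Reasoning

ascents-reverse-short : ∀ (A H B : List (Fin w)) → length H ≤ 2 → ascents (A ++ H ++ B) ≤ suc (ascents (A ++ reverse H ++ B))
ascents-reverse-short A []          B _ = n≤1+n _
ascents-reverse-short A (x ∷ [])    B _ = n≤1+n _
ascents-reverse-short A (x ∷ y ∷ []) B _ = ascents-swap A x y B
ascents-reverse-short A (x ∷ y ∷ z ∷ H) B (s≤s (s≤s ()))

-- If both headshunts hold two wagons, their lengths agree and `same` applies. Otherwise one of them
-- reads the same in both directions, and reversing the other costs at most one swap.
ascents-shunt : ∀ (A H B A′ H′ B′ : List (Fin w)) → length H ≤ 2 → length H′ ≤ 2 →
  ascents (A ++ reverse H ++ B) ≡ ascents (A′ ++ reverse H′ ++ B′) →
  (length H ≡ length H′ → ascents (A ++ H ++ B) ≡ ascents (A′ ++ H′ ++ B′)) →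
  ascents (A ++ H ++ B) ≤ suc (ascents (A′ ++ H′ ++ B′))
ascents-shunt A H B A′ H′ B′ le le′ eq same with length H ≤? 1 | length H′ ≤? 1
... | no 2≤ | no 2≤′ = ≤-trans (≤-reflexive (same (trans (≤-antisym le (≰⇒> 2≤)) (≤-antisym (≰⇒> 2≤′) le′)))) (n≤1+n _)
... | yes le₁ | _ = begin
  ascents (A ++ H ++ B)                  ≡⟨ cong (λ l → ascents (A ++ l ++ B)) (reverse-short H le₁) ⟨
  ascents (A ++ reverse H ++ B)          ≡⟨ eq ⟩
  ascents (A′ ++ reverse H′ ++ B′)       ≤⟨ ascents-reverse-short A′ (reverse H′) B′ (subst (_≤ 2) (sym (length-reverse H′)) le′) ⟩
  suc (ascents (A′ ++ reverse (reverse H′) ++ B′)) ≡⟨ cong (λ l → suc (ascents (A′ ++ l ++ B′))) (reverse-involutive H′) ⟩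
  suc (ascents (A′ ++ H′ ++ B′))         ∎
  where open ≤-Reasoning
... | no _ | yes le₁ = begin
  ascents (A ++ H ++ B)                  ≤⟨ ascents-reverse-short A H B le ⟩
  suc (ascents (A ++ reverse H ++ B))    ≡⟨ cong suc eq ⟩
  suc (ascents (A′ ++ reverse H′ ++ B′)) ≡⟨ cong (λ l → suc (ascents (A′ ++ l ++ B′))) (reverse-short H′ le₁) ⟩
  suc (ascents (A′ ++ H′ ++ B′))         ∎
  where open ≤-Reasoning

potential : Config w 2 → ℕ
potential (W₀ , W₁ ∷ W₂ ∷ []) = ascents (reverse W₁ ++ W₀ ++ W₂) + ascents (reverse W₁ ++ reverse W₀ ++ W₂)

-- Each move fixes one of the two readings of the line and, as the headshunt holds
-- two wagons, changes the other by at most one adjacent swap.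
potential-move : ∀ {m : Vec ℕ 2} {c c′ : Config w 2} → Move 2 m c c′ → potential c ≤ suc (potential c′)
potential-move {c = W₀ , W₁ ∷ W₂ ∷ []} {W₀′ , W₁′ ∷ W₂′ ∷ []} (mkMove p p′ _ zero others shunt)
  with refl ← others (suc zero) (λ ()) =
  +-mono-≤ (ascents-shunt (reverse W₁) W₀ W₂ (reverse W₁′) W₀′ W₂ (IsPosition.headCap p) (IsPosition.headCap p′) fixed same)
           (≤-reflexive fixed)
  where
  reading : ∀ W₀ W₁ → reverse W₁ ++ reverse W₀ ++ W₂ ≡ reverse (W₀ ++ W₁) ++ W₂
  reading W₀ W₁ = trans (sym (++-assoc (reverse W₁) (reverse W₀) W₂)) (cong (_++ W₂) (sym (reverse-++ W₀ W₁)))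
  fixed : ascents (reverse W₁ ++ reverse W₀ ++ W₂) ≡ ascents (reverse W₁′ ++ reverse W₀′ ++ W₂)
  fixed = cong ascents (trans (reading W₀ W₁) (trans (cong (λ l → reverse l ++ W₂) shunt) (sym (reading W₀′ W₁′))))
  same : length W₀ ≡ length W₀′ → ascents (reverse W₁ ++ W₀ ++ W₂) ≡ ascents (reverse W₁′ ++ W₀′ ++ W₂)
  same len with refl ← prefix-unique W₀ W₀′ len shunt with refl ← ++-cancelˡ W₀ W₁ W₁′ shunt = refl
potential-move {c = W₀ , W₁ ∷ W₂ ∷ []} {W₀′ , W₁′ ∷ W₂′ ∷ []} (mkMove p p′ _ (suc zero) others shunt)
  with refl ← others zero (λ ()) = begin
  fwd + bwd                   ≤⟨ +-mono-≤ (≤-reflexive fixed) (ascents-shunt (reverse W₁) (reverse W₀) W₂ (reverse W₁) (reverse W₀′) W₂′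
                                   (cap W₀ (IsPosition.headCap p)) (cap W₀′ (IsPosition.headCap p′))
                                   (trans (cong (λ l → ascents (reverse W₁ ++ l ++ W₂)) (reverse-involutive W₀))
                                     (trans fixed (cong (λ l → ascents (reverse W₁ ++ l ++ W₂′)) (sym (reverse-involutive W₀′))))) same) ⟩
  fwd′ + suc bwd′             ≡⟨ +-suc fwd′ bwd′ ⟩
  suc (fwd′ + bwd′)           ∎
  where
  open ≤-Reasoning
  fwd  = ascents (reverse W₁ ++ W₀ ++ W₂)
  bwd  = ascents (reverse W₁ ++ reverse W₀ ++ W₂)
  fwd′ = ascents (reverse W₁ ++ W₀′ ++ W₂′)
  bwd′ = ascents (reverse W₁ ++ reverse W₀′ ++ W₂′)
  cap : ∀ (l : List (Fin _)) → length l ≤ 2 → length (reverse l) ≤ 2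
  cap l = subst (_≤ 2) (sym (length-reverse l))
  fixed : fwd ≡ fwd′
  fixed = cong (λ l → ascents (reverse W₁ ++ l)) shunt
  same : length (reverse W₀) ≡ length (reverse W₀′) → bwd ≡ bwd′
  same len with refl ← prefix-unique W₀ W₀′ (trans (sym (length-reverse W₀)) (trans len (length-reverse W₀′))) shunt
           with refl ← ++-cancelˡ W₀ W₂ W₂′ shunt = refl

potential-path : ∀ {m : Vec ℕ 2} {c c′ : Config w 2} → Path 2 m n c c′ → potential c ≤ n + potential c′
potential-path here        = ≤-refl
potential-path {c = c} (there {c' = d} μ p) = ≤-trans (potential-move {c = c} {d} μ) (s≤s (potential-path p))

weight-less-suc : ∀ (x : Fin w) l → weight (less (suc x)) (map suc l) ≡ weight (less x) l
weight-less-suc x []      = refl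
weight-less-suc x (y ∷ l) = cong (less x y +_) (weight-less-suc x l)

weight-less-zero : ∀ (l : List (Fin w)) → weight (less zero) (map suc l) ≡ length l
weight-less-zero []      = refl
weight-less-zero (y ∷ l) = cong suc (weight-less-zero l)

ascents-suc : ∀ (l : List (Fin w)) → ascents (map suc l) ≡ ascents l
ascents-suc []      = refl
ascents-suc (x ∷ l) = cong₂ _+_ (weight-less-suc x l) (ascents-suc l)

ascents-∷ʳ-zero : ∀ (l : List (Fin w)) → ascents (map suc l ∷ʳ zero) ≡ ascents l
ascents-∷ʳ-zero []      = refl
ascents-∷ʳ-zero (x ∷ l) = cong₂ _+_ (trans (weight-∷ʳ (less (suc x)) (map suc l) zero) (weight-less-suc x l)) (ascents-∷ʳ-zero l)

allFin-suc : ∀ w → allFin (suc w) ≡ zero ∷ map suc (allFin w)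
allFin-suc w = cong (zero ∷_) (sym (map-tabulate id suc))

reverse-allFin-suc : ∀ w → reverse (allFin (suc w)) ≡ map suc (reverse (allFin w)) ∷ʳ zero
reverse-allFin-suc w = trans (cong reverse (allFin-suc w))
  (trans (unfold-reverse zero (map suc (allFin w))) (cong (_∷ʳ zero) (sym (reverse-map suc (allFin w)))))

-- Two copies make w(w - 1), written so as to avoid halving and subtraction. A new least wagon in
-- front forms an ascent with each of the others.
ascents-allFin : ∀ w → ascents (allFin w) + ascents (allFin w) + w ≡ w * w
ascents-allFin zero    = refl
ascents-allFin (suc w) = begin
  ascents (allFin (suc w)) + ascents (allFin (suc w)) + suc w   ≡⟨ cong (λ z → z + z + suc w) top ⟩
  (w + up) + (w + up) + suc w                                     ≡⟨ solve 2 (λ w up → w :+ up :+ (w :+ up) :+ (con 1 :+ w) := up :+ up :+ w :+ (con 1 :+ w :+ w)) refl w up ⟩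
  up + up + w + (1 + w + w)                                       ≡⟨ cong (_+ (1 + w + w)) (ascents-allFin w) ⟩
  w * w + (1 + w + w)                                           ≡⟨ solve 1 (λ w → w :* w :+ (con 1 :+ w :+ w) := (con 1 :+ w) :* (con 1 :+ w)) refl w ⟩
  suc w * suc w                                                 ∎
  where
  open ≡-Reasoning
  up = ascents (allFin w)
  top : ascents (allFin (suc w)) ≡ w + up
  top = trans (cong ascents (allFin-suc w))
    (cong₂ _+_ (trans (weight-less-zero (allFin w)) (length-tabulate id)) (ascents-suc (allFin w)))

ascents-reverse-allFin : ∀ w → ascents (reverse (allFin w)) ≡ 0
ascents-reverse-allFin zero    = refl
ascents-reverse-allFin (suc w) =
  trans (cong ascents (reverse-allFin-suc w)) (trans (ascents-∷ʳ-zero (reverse (allFin w))) (ascents-reverse-allFin w))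

-- The reversal puzzle

module Reversal (v : ℕ) where

  size : ℕ
  size = suc v

  lengths : Vec ℕ 2
  lengths = size ∷ size ∷ []

  layout : ValidLayout size 2 2 lengths
  layout = record
    { s-pos = s≤s z≤n
    ; h-pos = s≤s z≤n
    ; m-pos = λ { zero → s≤s z≤n ; (suc zero) → s≤s z≤n }
    ; room  = s≤s (≤-trans (m≤m+n size _) (n≤1+n _))
    }

  parked : List (Fin size) → Config size 2
  parked l = [] , [] ∷ l ∷ []

  parked-position : ∀ {l} → l ↭ allFin size → IsPosition 2 lengths (parked l)
  parked-position {l} perm = mkPos (↭-trans (↭-reflexive (++-identityʳ l)) perm) z≤n
    λ { zero → z≤n ; (suc zero) → ≤-reflexive (trans (↭-length perm) (length-tabulate id)) }

  reversed : Config size 2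
  reversed = parked (reverse (allFin size))

  -- Taking all positions as starts makes closure under relabelling automatic, and the decreasing
  -- order puts wagon `zero` last in the second siding.
  puzzle : Puzzle size 2 2 lengths
  puzzle = record
    { Start     = IsPosition 2 lengths
    ; Finish    = _≡ reversed
    ; startPos  = λ _ pos → pos
    ; finishPos = λ { _ refl → parked-position (↭-reverse (allFin size)) }
    }

  natural : Natural puzzle
  natural = record
    { startClosed = permute-position
    ; z           = suc zero
    ; ω           = zero
    ; lastIsω     = λ { _ refl → trans (cong last (reverse-allFin-suc v)) (last-++ (map suc (reverse (allFin v))) zero []) }
    }

  rearrangeable : Feasible size (caps 1 lengths)
  rearrangeable = inj₂ (spare , rich-three zero (suc zero) (suc (suc zero)) (λ ()) (λ ()) (λ ()) (s≤s z≤n) (s≤s z≤n) (s≤s z≤n))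
    where
    below : ∀ {x} → x ≤ size → size + x ≤ 1 + (size + (size + 0))
    below le = ≤-trans (+-monoʳ-≤ size (≤-trans le (m≤m+n size 0))) (n≤1+n _)
    spare : Spare size (caps 1 lengths)
    spare zero             = below (s≤s z≤n)
    spare (suc zero)       = below ≤-refl
    spare (suc (suc zero)) = below ≤-refl

  solvable : AlwaysSolvable puzzle
  solvable p pos = proj₁ path , reversed , refl , proj₂ (proj₂ path)
    where
    path = connected {h = 1} {m = lengths} (ValidLayout.room layout) rearrangeable pos
             (parked-position (↭-reverse (allFin size)))

  -- The potential falls from w(w - 1) to zero, so `n` is at least w(w - 1). Since w(w - 1) ≥ w - 1,
  -- doubling gives at least w² - 1.
  many-moves : ∀ n → SolvableIn puzzle n (parked (allFin size)) → size * size ∸ 1 ≤ 2 * n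
  many-moves n (_ , refl , path) = begin
    size * size ∸ 1                   ≡⟨ cong (_∸ 1) (ascents-allFin size) ⟨
    up + up + size ∸ 1                  ≡⟨ cong (_∸ 1) (+-suc (up + up) v) ⟩
    up + up + v                         ≤⟨ +-monoʳ-≤ (up + up) v≤ ⟩
    up + up + (up + up)                   ≤⟨ +-mono-≤ 2up≤n 2up≤n ⟩
    n + n                             ≡⟨ cong (n +_) (+-identityʳ n) ⟨
    2 * n                             ∎
    where
    open ≤-Reasoning
    up = ascents (allFin size)
    v≤ : v ≤ up + up
    v≤ = cancel-≤ size {x = v} {y = up + up} (≤-trans (m≤m+n (v + size) (v * v))
      (≤-reflexive (solve 1 (λ v → v :+ (con 1 :+ v) :+ v :* v := (con 1 :+ v) :* (con 1 :+ v)) refl v)))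
      refl (sym (ascents-allFin size))
    2up≤n : up + up ≤ n
    2up≤n = begin
      up + up                          ≤⟨ potential-path path ⟩
      n + (d + d)                    ≡⟨ cong (λ z → n + (z + z)) (ascents-reverse-allFin size) ⟩
      n + 0                          ≡⟨ +-identityʳ n ⟩
      n                              ∎
      where d = ascents (reverse (allFin size))

-- The two bounds

upper-bound : (w : ℕ) → 0 < w → (s h : ℕ) → (m : Vec ℕ s) → ValidLayout w s h m →
  (P : Puzzle w s h m) → Natural P → AlwaysSolvable P →
  ∀ p → Start P p →
  ∃[ n ] (n ≤ 2 * w * w + 12 * w ∸ 10 × SolvableIn P n p)
upper-bound _ _ _ zero _ layout _ _ _ _ _ with () ← ValidLayout.h-pos layout
upper-bound (suc v) _ _ (suc h) m layout P natural solvable p start =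
  proj₁ path , ≤-trans (proj₁ (proj₂ path)) (≤-reflexive (budget v)) , q , finished , proj₂ (proj₂ path)
  where
  -- The given solution only supplies a finishing position; a path to it of bounded length is then
  -- built afresh.
  q        = proj₁ (proj₂ (solvable p start))
  finished = proj₁ (proj₂ (proj₂ (solvable p start)))
  path     = connected {h = h} {m = m} (ValidLayout.room layout) (feasible layout natural solvable start)
               (startPos P p start) (finishPos P q finished)

lower-bound : (w : ℕ) → 0 < w →
  Σ ℕ λ s → Σ ℕ λ h → Σ (Vec ℕ s) λ m → ValidLayout w s h m ×
  Σ (Puzzle w s h m) λ P → Natural P × AlwaysSolvable P ×
  ∃[ p ] (Start P p × (∀ n → SolvableIn P n p → w * w ∸ 1 ≤ 2 * n))
lower-bound (suc v) _ = 2 , 2 , lengths , layout , puzzle , natural , solvable ,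
  parked (allFin size) , parked-position ↭-refl , many-moves
  where open Reversal v

theorem7 : ((w : ℕ) → 0 < w → (s h : ℕ) → (m : Vec ℕ s) → ValidLayout w s h m →
    (P : Puzzle w s h m) → Natural P → AlwaysSolvable P →
    ∀ p → Start P p →
    ∃[ n ] (n ≤ 2 * w * w + 12 * w ∸ 10 × SolvableIn P n p))
    ×
    ((w : ℕ) → 0 < w →
    Σ ℕ λ s → Σ ℕ λ h → Σ (Vec ℕ s) λ m → ValidLayout w s h m ×
    Σ (Puzzle w s h m) λ P → Natural P × AlwaysSolvable P ×
    ∃[ p ] (Start P p × (∀ n → SolvableIn P n p → w * w ∸ 1 ≤ 2 * n)))
theorem7 = upper-bound , lower-bound
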